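{- There is an absolute constant $C>0$ such that for every $k\ge 1$, every choice of weights $0<w_1\le\dots\le w_k$ and every finite uniform metric space $U$, there is a randomized online algorithm for Weighted $k$-Server -- Revealed Service Pattern (W$k$S-RSP) whose expected cost on every valid input is at most $2^{Ck^2}$ times the cost of the final service pattern revealed by the adversary; i.e. W$k$S-RSP admits a $2^{O(k^2)}$-competitive randomized algorithm.
   Context: Uniform metric: a finite set $U$ of points, every two distinct points at distance $1$. There are $k$ servers, server $i$ has weight $w_i$; the cost of a solution is $\sum_i w_i\cdot(\text{number of moves of server } i)$. A (hierarchical) service pattern over $[1,T+1)$ is a $k$-tuple $\mathcal I=(\mathcal I^1,\dots,\mathcal I^k)$ where each level $\mathcal I^\ell$ is a partition of $[1,T+1)$ into left-closed right-open intervals with integer endpoints, and $\mathcal I^\ell$ refines $\mathcal I^{\ell+1}$ for each $\ell<k$. Its cost is $\sum_\ell w_\ell|\mathcal I^\ell|$. A labeling is a function from the multiset $\mathcal I^1\uplus\dots\uplus\mathcal I^k$ to $U$; it is feasible with respect to a request sequence $(\sigma_1,\dots,\sigma_T)$ if for each $t$ some interval containing $t$ is labeled $\sigma_t$; a service pattern is feasible if it has a feasible labeling. For a service pattern $\mathcal I_{t-1}$ over $[1,t)$ with last intervals $L^i_{t-1}\in\mathcal I^i_{t-1}$, and $\ell\in\{0,\dots,k\}$, the $\ell$-extension $\mathcal I_t$ over $[1,t+1)$ is obtained by adding $[t,t+1)$ as a new interval to each level $i\le\ell$ and replacing $L^i_{t-1}$ by $L^i_{t-1}\cup[t,t+1)$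 in each level $i>\ell$. W$k$S-RSP: in round $t=1,2,\dots,T$ the online algorithm receives a pair $(\sigma_t,\ell_t)$ with $\sigma_t\in U$ and $\ell_t\in\{0,\dots,k\}$ (with $\ell_1=k$), where it is guaranteed that the revealed pattern $\mathcal I_t$, the $\ell_t$-extension of $\mathcal I_{t-1}$, is feasible with respect to $(\sigma_1,\dots,\sigma_t)$. The algorithm must then move its servers so that some server is located at $\sigma_t$. Its cost is compared to the cost of the final revealed service pattern $\mathcal I_T$.
   Formalization: The weights w_1 ≤ … ≤ w_k are taken to be positive rational numbers instead of positive real numbers. -}

module Defs where

open import Data.Nat as ℕ using (ℕ; zero; suc; _<?_)
open import Data.Fin as Fin using (Fin; toℕ; _≟_)
open import Data.Integer using (+_)
open import Data.Rational using (ℚ; 0ℚ; 1ℚ; _+_; _*_; _≤_; _/_)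
open import Data.List as List using (List; []; _∷_; length; lookup; take; map)
open import Data.List.Relation.Unary.All using (All)
open import Data.Product using (Σ; ∃; ∃-syntax; _×_; _,_; proj₁)
open import Data.Bool using (if_then_else_)
open import Relation.Nullary.Decidable using (⌊_⌋)
open import Relation.Binary.PropositionalEquality using (_≡_)

-- Uniform metric space U = Fin n (distance 1 between distinct points),
-- k servers, server i ∈ Fin k (level/server i corresponds to paper's i+1).

sumFin : (k : ℕ) → (Fin k → ℚ) → ℚ
sumFin zero    f = 0ℚ
sumFin (suc k) f = f Fin.zero + sumFin k (λ i → f (Fin.suc i))

sumList : List ℚ → ℚ
sumList = List.foldr _+_ 0ℚ

Interval : Set
Interval = ℕ × ℕ

_∈ᵢ_ : ℕ → Interval → Set
t ∈ᵢ (s , e) = (s ℕ.≤ t) × (t ℕ.< e)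

-- A hierarchical service pattern: for each level i a list of intervals,
-- stored NEWEST FIRST (the head is the last interval L^i).
Pattern : ℕ → Set
Pattern k = Fin k → List Interval

patternCost : {k : ℕ} → (Fin k → ℚ) → Pattern k → ℚ
patternCost {k} w P = sumFin k (λ i → w i * ((+ length (P i)) / 1))

emptyPattern : (k : ℕ) → Pattern k
emptyPattern k i = []

-- ℓ-extension at time t: levels with index ≤ ℓ (paper numbering, i.e.
-- toℕ i < ℓ here) get the new interval [t,t+1); the other levels have
-- their last interval extended by [t,t+1).
extend : {k : ℕ} → ℕ → ℕ → Pattern k → Pattern k
extend t ℓ P i with ⌊ toℕ i <? ℓ ⌋ | P i
... | Data.Bool.true  | Is         = (t , suc t) ∷ Is
... | Data.Bool.false | []         = (t , suc t) ∷ []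
... | Data.Bool.false | (s , e) ∷ Is = (s , suc t) ∷ Is

Input : ℕ → ℕ → Set
Input k n = Fin n × Fin (suc k)

revealFrom : {k n : ℕ} → ℕ → Pattern k → List (Input k n) → Pattern k
revealFrom t P []             = P
revealFrom t P ((σ , ℓ) ∷ xs) = revealFrom (suc t) (extend t (toℕ ℓ) P) xs

revealed : {k n : ℕ} → List (Input k n) → Pattern k
revealed {k} xs = revealFrom 1 (emptyPattern k) xs

Labeling : (k n : ℕ) → Pattern k → Set
Labeling k n P = (i : Fin k) → Fin (length (P i)) → Fin n

-- feasibility of a labeling w.r.t. σ_1 … σ_T (σs is listed oldest first,
-- σs[t] is the request at time t+1)
FeasibleLabeling : {k n : ℕ} (P : Pattern k) → Labeling k n P → List (Fin n) → Set
FeasibleLabeling {k} P lab σs =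
  (t : Fin (length σs)) → ∃[ i ] ∃[ j ]
    ((suc (toℕ t) ∈ᵢ lookup (P i) j) × (lab i j ≡ lookup σs t))

Feasible : {k : ℕ} (n : ℕ) → Pattern k → List (Fin n) → Set
Feasible {k} n P σs = Σ (Labeling k n P) (λ lab → FeasibleLabeling P lab σs)

ValidInput : {k n : ℕ} → List (Input k n) → Set
ValidInput {k} {n} [] = Data.Unit.⊤ where import Data.Unit
ValidInput {k} {n} xs@((σ₁ , ℓ₁) ∷ _) =
  (toℕ ℓ₁ ≡ k) ×
  ((t : ℕ) → 1 ℕ.≤ t → t ℕ.≤ length xs →
     Feasible n (revealed (take t xs)) (map proj₁ (take t xs)))

Config : ℕ → ℕ → Set
Config k n = Fin k → Fin n

Dist : ℕ → ℕ → Set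
Dist k n = List (ℚ × Config k n)

-- A randomized online algorithm (behavioural form): in round t it sees
-- the current request (σ_t,ℓ_t), the earlier requests (newest first), its
-- current configuration and its earlier configurations (newest first,
-- ending with the initial configuration), and outputs a distribution of
-- the configuration after serving round t.
Alg : ℕ → ℕ → Set
Alg k n = Input k n → List (Input k n) → Config k n → List (Config k n) → Dist k n

Covers : {k n : ℕ} → Config k n → Fin n → Set
Covers c σ = ∃[ i ] (c i ≡ σ)

ValidDist : {k n : ℕ} → Fin n → Dist k n → Set
ValidDist σ d =
  All (λ pc → (0ℚ ≤ proj₁ pc) × Covers (Data.Product.proj₂ pc) σ) d ×
  (sumList (map proj₁ d) ≡ 1ℚ)

ValidAlg : {k n : ℕ} → Alg k n → Set
ValidAlg {k} {n} A =
  (x : Input k n) (past : List (Input k n)) (c : Config k n) (cs : List (Config k n)) →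
  ValidDist (proj₁ x) (A x past c cs)

moveCost : {k n : ℕ} → (Fin k → ℚ) → Config k n → Config k n → ℚ
moveCost {k} w c c' = sumFin k (λ i → if ⌊ c i ≟ c' i ⌋ then 0ℚ else w i)

expCostFrom : {k n : ℕ} → (Fin k → ℚ) → Alg k n →
  List (Input k n) → Config k n → List (Config k n) → List (Input k n) → ℚ
expCostFrom w A past c cs []         = 0ℚ
expCostFrom w A past c cs (x ∷ fut) =
  sumList (map (λ pc → proj₁ pc *
      (moveCost w c (Data.Product.proj₂ pc) +
       expCostFrom w A (x ∷ past) (Data.Product.proj₂ pc) (c ∷ cs) fut))
    (A x past c cs))

expCost : {k n : ℕ} → (Fin k → ℚ) → Alg k n → Config k n → List (Input k n) → ℚ
expCost w A c₀ xs = expCostFrom w A [] c₀ [] xs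

{-# OPTIONS --safe #-}

-- Fix an interval of level j and a set C of labels used above it.  Consider the sets S of further points
-- such that all requests outside C ∪ S can be served by the levels up to j.  This upward closed family is
-- generated by sets with the Kraft inequality ∑ z^|S| ≤ 1, where z = 2^(1 - 2^j): for the intersection of such
-- families over subintervals one generates successively, which keeps z, and passing to the next level deletes
-- one element from each set, which replaces z by z²/2.  Hence, given the labels above it, the feasible labels of
-- an interval of level j + 1 are either all points or at most 2^(2^j - 1) many.
--
-- The algorithm keeps every label uniformly distributed over the feasible ones given the labels above it,
-- and resamples a label, with everything below it, when it becomes infeasible or its interval ends.
-- When m feasible labels shrink to m′, a label is lost with probability (m - m′)/m, so the expected number of
-- resamplings between two restarts by a higher level is at most 1 + H(2^(2^j - 1)) ≤ 1 + 2^j.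
-- Multiplying these factors over all levels gives 2^O(k²).
module Submission where

open import Defs
open import Data.Nat using (ℕ; _^_; _≤_)
open import Data.Fin using (Fin)
open import Data.Rational using (ℚ; 0ℚ; _/_; _*_) renaming (_<_ to _<ℚ_; _≤_ to _≤ℚ_)
open import Data.List using (List)
open import Data.Product using (Σ; ∃-syntax; _×_)

open import Algebra.Properties.Group using (∙-cancelˡ)
open import Data.Bool using (if_then_else_)
open import Data.Empty using (⊥-elim)
open import Data.Fin using (zero; suc; toℕ; fromℕ; inject₁; opposite)
import Data.Fin.Properties as Finₚ
open import Data.Fin.Relation.Unary.Top using (view; ‵fromℕ; ‵inject₁)
import Data.Integer as ℤ
import Data.Integer.Properties as ℤₚ
open import Data.List using ([]; _∷_; length; map; _++_; filter; concatMap; allFin; lookup; reverse; _ʳ++_)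
open import Data.List.Membership.Propositional using (_∈_; _∉_; find)
open import Data.List.Membership.Propositional.Properties using (∈-++⁺ˡ; ∈-++⁺ʳ; ∈-++⁻; ∈-filter⁺; ∈-filter⁻; ∈-∃++; ∈-allFin; ∈-length)
import Data.List.Properties as Listₚ
open import Data.List.Relation.Binary.Subset.Propositional using (_⊆_)
open import Data.List.Relation.Unary.All as All using (All; []; _∷_)
import Data.List.Relation.Unary.All.Properties as Allₚ
open import Data.List.Relation.Unary.AllPairs using ([]; _∷_)
open import Data.List.Relation.Unary.Any as Any using (Any; here; there)
import Data.List.Relation.Unary.Any.Properties as Anyₚ
open import Data.List.Relation.Unary.Unique.Propositional using (Unique)
import Data.List.Relation.Unary.Unique.Propositional.Properties as Uniqueₚ
open import Data.Nat as ℕ using (zero; suc; z≤n; s≤s; _≤?_; _<?_)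
open import Data.Nat.Coprimality as Coprime using (1-coprimeTo)
import Data.Nat.Properties as ℕₚ
open import Data.Product using (Σ-syntax; _,_; proj₁; proj₂)
open import Data.Rational using (1ℚ; ½; _+_; _-_; nonNegative; *≤*; mkℚ)
open import Data.Rational.Properties hiding (_≤?_; _<?_; _≟_)
open import Data.Rational.Solver using (module +-*-Solver)
open import Data.Sum using (_⊎_; inj₁; inj₂)
open import Data.Unit using (⊤; tt)
open import Data.Vec as Vec using (Vec; []; _∷_)
open import Data.Vec.Relation.Unary.All as VAll using ([]; _∷_)
open import Function using (_∘_; id)
open import Level using (0ℓ)
open import Relation.Binary.PropositionalEquality using (_≡_; refl; sym; trans; cong; cong₂; subst; module ≡-Reasoning)
open import Relation.Nullary using (¬_; Dec; yes; no; does)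
open import Relation.Nullary.Decidable using (⌊_⌋; dec-true; dec-false)
open import Relation.Unary using (Pred; Decidable)
open +-*-Solver using (solve; _:=_; _:+_; _:*_; _:-_; con)

-- Finite sums and averages of rationals

0≤1 : 0ℚ ≤ℚ 1ℚ
0≤1 = *≤* (ℤ.+≤+ z≤n)

0≤½ : 0ℚ ≤ℚ ½
0≤½ = *≤* (ℤ.+≤+ z≤n)

*-monoʳ : ∀ {c p q} → 0ℚ ≤ℚ c → p ≤ℚ q → c * p ≤ℚ c * q
*-monoʳ {c} 0≤c p≤q = *-monoˡ-≤-nonNeg c {{nonNegative 0≤c}} p≤q

*-monoˡ : ∀ {c p q} → 0ℚ ≤ℚ c → p ≤ℚ q → p * c ≤ℚ q * c
*-monoˡ {c} 0≤c p≤q = *-monoʳ-≤-nonNeg c {{nonNegative 0≤c}} p≤q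

*-nonNeg : ∀ {p q} → 0ℚ ≤ℚ p → 0ℚ ≤ℚ q → 0ℚ ≤ℚ p * q
*-nonNeg {p} 0≤p 0≤q = subst (_≤ℚ p * _) (*-zeroʳ p) (*-monoʳ 0≤p 0≤q)

+-nonNeg : ∀ {p q} → 0ℚ ≤ℚ p → 0ℚ ≤ℚ q → 0ℚ ≤ℚ p + q
+-nonNeg 0≤p 0≤q = +-mono-≤ 0≤p 0≤q

≤-+ʳ : ∀ {p q} → 0ℚ ≤ℚ q → p ≤ℚ p + q
≤-+ʳ {p} {q} 0≤q = subst (_≤ℚ p + q) (+-identityʳ p) (+-monoʳ-≤ p 0≤q)

≤-+ˡ : ∀ {p q} → 0ℚ ≤ℚ p → q ≤ℚ p + q
≤-+ˡ {p} {q} 0≤p = subst (_≤ℚ p + q) (+-identityˡ q) (+-monoˡ-≤ q 0≤p)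

ι : ℕ → ℚ
ι m = ℤ.+ m / 1

-- `_/_` normalises by a gcd that is stuck for a variable `m`; in the canonical form on the right,
-- order and arithmetic can be read off the numerators.
ι-mkℚ : ∀ m → ι m ≡ mkℚ (ℤ.+ m) 0 (Coprime.sym (1-coprimeTo m))
ι-mkℚ m = fromℚᵘ-toℚᵘ (mkℚ (ℤ.+ m) 0 _)

ι-mono : ∀ {m n} → m ℕ.≤ n → ι m ≤ℚ ι n
ι-mono {m} {n} m≤n rewrite ι-mkℚ m | ι-mkℚ n = *≤* (ℤₚ.*-monoʳ-≤-nonNeg (ℤ.+ 1) (ℤ.+≤+ m≤n))

ι-cancel : ∀ {m n} → ι m ≤ℚ ι n → m ℕ.≤ n
ι-cancel {m} {n} p rewrite ι-mkℚ m | ι-mkℚ n = ℤₚ.drop‿+≤+ (ℤₚ.*-cancelʳ-≤-pos (ℤ.+ m) (ℤ.+ n) (ℤ.+ 1) (drop-*≤* p))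

ι-+ : ∀ m n → ι (m ℕ.+ n) ≡ ι m + ι n
ι-+ m n rewrite ι-mkℚ m | ι-mkℚ n =
  cong (_/ 1) (sym (cong₂ ℤ._+_ (ℤₚ.*-identityʳ (ℤ.+ m)) (ℤₚ.*-identityʳ (ℤ.+ n))))

ι-* : ∀ m n → ι (m ℕ.* n) ≡ ι m * ι n
ι-* m n rewrite ι-mkℚ m | ι-mkℚ n = cong (_/ 1) (ℤₚ.pos-* m n)

ι-suc : ∀ m → ι (suc m) ≡ 1ℚ + ι m
ι-suc m = ι-+ 1 m

0≤ι : ∀ m → 0ℚ ≤ℚ ι m
0≤ι m = ι-mono {0} {m} z≤n

-- The default value at 0 makes averages over empty lists vanish, so monotonicity and nonnegativity
-- of `avg` need no nonemptiness assumption.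
inv : ℕ → ℚ
inv zero    = 0ℚ
inv (suc m) = mkℚ (ℤ.+ 1) m (1-coprimeTo (suc m))

0≤inv : ∀ m → 0ℚ ≤ℚ inv m
0≤inv zero    = ≤-refl
0≤inv (suc m) = *≤* (ℤ.+≤+ z≤n)

inv-ι : ∀ m → inv (suc m) * ι (suc m) ≡ 1ℚ
inv-ι m rewrite ι-mkℚ (suc m) = *-inverseˡ (mkℚ (ℤ.+ suc m) 0 (Coprime.sym (1-coprimeTo (suc m))))

inv-ι⁺ : ∀ {m} → 1 ℕ.≤ m → inv m * ι m ≡ 1ℚ
inv-ι⁺ (s≤s {n = m} _) = inv-ι m

inv-anti : ∀ {m n} → m ℕ.≤ n → inv (suc n) ≤ℚ inv (suc m)
inv-anti m≤n = *≤* (ℤ.+≤+ (s≤s (ℕₚ.+-monoˡ-≤ 0 m≤n)))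

∑ : ∀ {A : Set} → List A → (A → ℚ) → ℚ
∑ L h = sumList (map h L)

∑-cong : ∀ {A : Set} (L : List A) {f g : A → ℚ} → (∀ a → f a ≡ g a) → ∑ L f ≡ ∑ L g
∑-cong []      e = refl
∑-cong (a ∷ L) e = cong₂ _+_ (e a) (∑-cong L e)

∑-cong-All : ∀ {A : Set} {L : List A} {f g : A → ℚ} → All (λ a → f a ≡ g a) L → ∑ L f ≡ ∑ L g
∑-cong-All []       = refl
∑-cong-All (e ∷ es) = cong₂ _+_ e (∑-cong-All es)

∑-mono-All : ∀ {A : Set} {L : List A} {f g : A → ℚ} → All (λ a → f a ≤ℚ g a) L → ∑ L f ≤ℚ ∑ L g
∑-mono-All []       = ≤-refl
∑-mono-All (e ∷ es) = +-mono-≤ e (∑-mono-All es)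

∑-+ : ∀ {A : Set} (L : List A) (f g : A → ℚ) → ∑ L (λ a → f a + g a) ≡ ∑ L f + ∑ L g
∑-+ []      f g = refl
∑-+ (a ∷ L) f g = trans (cong ((f a + g a) +_) (∑-+ L f g))
  (solve 4 (λ x y s t → (x :+ y) :+ (s :+ t) := (x :+ s) :+ (y :+ t)) refl (f a) (g a) (∑ L f) (∑ L g))

∑-*ˡ : ∀ {A : Set} (L : List A) (c : ℚ) (f : A → ℚ) → ∑ L (λ a → c * f a) ≡ c * ∑ L f
∑-*ˡ []      c f = sym (*-zeroʳ c)
∑-*ˡ (a ∷ L) c f = trans (cong (c * f a +_) (∑-*ˡ L c f)) (sym (*-distribˡ-+ c (f a) (∑ L f)))

∑-++ : ∀ {A : Set} (L M : List A) (f : A → ℚ) → ∑ (L ++ M) f ≡ ∑ L f + ∑ M f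
∑-++ []      M f = sym (+-identityˡ (∑ M f))
∑-++ (a ∷ L) M f = trans (cong (f a +_) (∑-++ L M f)) (sym (+-assoc (f a) (∑ L f) (∑ M f)))

∑-map : ∀ {A B : Set} (g : A → B) (L : List A) (f : B → ℚ) → ∑ (map g L) f ≡ ∑ L (λ a → f (g a))
∑-map g []      f = refl
∑-map g (a ∷ L) f = cong (f (g a) +_) (∑-map g L f)

∑-concatMap : ∀ {A B : Set} (g : A → List B) (L : List A) (f : B → ℚ) →
              ∑ (concatMap g L) f ≡ ∑ L (λ a → ∑ (g a) f)
∑-concatMap g []      f = refl
∑-concatMap g (a ∷ L) f = trans (∑-++ (g a) (concatMap g L) f) (cong (∑ (g a) f +_) (∑-concatMap g L f))

∑-const : ∀ {A : Set} (L : List A) (c : ℚ) → ∑ L (λ _ → c) ≡ ι (length L) * c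
∑-const []      c = sym (*-zeroˡ c)
∑-const (a ∷ L) c = trans (cong (c +_) (∑-const L c)) (trans
  (solve 2 (λ c l → c :+ l :* c := (con 1ℚ :+ l) :* c) refl c (ι (length L)))
  (cong (_* c) (sym (ι-suc (length L)))))

∑-nonNeg : ∀ {A : Set} (L : List A) {f : A → ℚ} → (∀ a → 0ℚ ≤ℚ f a) → 0ℚ ≤ℚ ∑ L f
∑-nonNeg []      p = ≤-refl
∑-nonNeg (a ∷ L) p = +-nonNeg (p a) (∑-nonNeg L p)

avg : ∀ {A : Set} → List A → (A → ℚ) → ℚ
avg L f = inv (length L) * ∑ L f

NonEmpty : ∀ {A : Set} → List A → Set
NonEmpty L = 1 ℕ.≤ length L

avg-cong-All : ∀ {A : Set} {L : List A} {f g : A → ℚ} → All (λ a → f a ≡ g a) L → avg L f ≡ avg L g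
avg-cong-All {L = L} e = cong (inv (length L) *_) (∑-cong-All e)

avg-mono-All : ∀ {A : Set} {L : List A} {f g : A → ℚ} → All (λ a → f a ≤ℚ g a) L → avg L f ≤ℚ avg L g
avg-mono-All {L = L} e = *-monoʳ (0≤inv (length L)) (∑-mono-All e)

avg-+ : ∀ {A : Set} (L : List A) (f g : A → ℚ) → avg L (λ a → f a + g a) ≡ avg L f + avg L g
avg-+ L f g = trans (cong (inv (length L) *_) (∑-+ L f g)) (*-distribˡ-+ (inv (length L)) (∑ L f) (∑ L g))

avg-*ˡ : ∀ {A : Set} (L : List A) (c : ℚ) (f : A → ℚ) → avg L (λ a → c * f a) ≡ c * avg L f
avg-*ˡ L c f = trans (cong (inv (length L) *_) (∑-*ˡ L c f))
  (solve 3 (λ i c s → i :* (c :* s) := c :* (i :* s)) refl (inv (length L)) c (∑ L f))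

avg-const : ∀ {A : Set} (L : List A) → NonEmpty L → (c : ℚ) → avg L (λ _ → c) ≡ c
avg-const L ne c = begin
  inv (length L) * ∑ L (λ _ → c)      ≡⟨ cong (inv (length L) *_) (∑-const L c) ⟩
  inv (length L) * (ι (length L) * c) ≡⟨ sym (*-assoc (inv (length L)) (ι (length L)) c) ⟩
  inv (length L) * ι (length L) * c   ≡⟨ cong (_* c) (inv-ι⁺ ne) ⟩
  1ℚ * c                              ≡⟨ *-identityˡ c ⟩
  c ∎
  where open ≡-Reasoning

avg-nonNeg : ∀ {A : Set} (L : List A) {f : A → ℚ} → (∀ a → 0ℚ ≤ℚ f a) → 0ℚ ≤ℚ avg L f
avg-nonNeg L p = *-nonNeg (0≤inv (length L)) (∑-nonNeg L p)

module _ {A : Set} {P Q : Pred A 0ℓ} (P? : Decidable P) (Q? : Decidable Q) (Q⇒P : ∀ {a} → Q a → P a) where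

  length-filter-⊆ : ∀ L → length (filter Q? L) ℕ.≤ length (filter P? L)
  length-filter-⊆ []      = z≤n
  length-filter-⊆ (a ∷ L) with P? a | Q? a
  ... | no ¬p | yes q = ⊥-elim (¬p (Q⇒P q))
  ... | no ¬p | no ¬q = length-filter-⊆ L
  ... | yes p | no ¬q = ℕₚ.m≤n⇒m≤1+n (length-filter-⊆ L)
  ... | yes p | yes q = s≤s (length-filter-⊆ L)

  module _ {h g : A → ℚ} {d : ℚ} (h-kept : ∀ {a} → Q a → h a ≡ g a) (h-lost : ∀ {a} → P a → ¬ Q a → h a ≡ d) where

    -- Compare element by element: a kept element contributes `g a + d` to both sides, a lost one
    -- `d`, any other nothing. Adding the multiples of `d` avoids subtraction.
    ∑-refine : ∀ L → ∑ (filter P? L) h + ι (length (filter Q? L)) * d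
                     ≡ ∑ (filter Q? L) g + ι (length (filter P? L)) * d
    ∑-refine []      = refl
    ∑-refine (a ∷ L) with P? a | Q? a
    ... | no ¬p | yes q = ⊥-elim (¬p (Q⇒P q))
    ... | no ¬p | no ¬q = ∑-refine L
    ... | yes p | no ¬q rewrite h-lost p ¬q | ι-suc (length (filter P? L)) = begin
      d + s + n * d    ≡⟨ +-assoc d s (n * d) ⟩
      d + (s + n * d)  ≡⟨ cong (d +_) (∑-refine L) ⟩
      d + (t + m * d)  ≡⟨ solve 3 (λ d t m → d :+ (t :+ m :* d) := t :+ (con 1ℚ :+ m) :* d) refl d t m ⟩
      t + (1ℚ + m) * d ∎
      where
      open ≡-Reasoning
      s = ∑ (filter P? L) h
      t = ∑ (filter Q? L) g
      n = ι (length (filter Q? L))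
      m = ι (length (filter P? L))
    ... | yes p | yes q rewrite h-kept q | ι-suc (length (filter P? L)) | ι-suc (length (filter Q? L)) = begin
      g a + s + (1ℚ + n) * d ≡⟨ solve 4 (λ x d s n → x :+ s :+ (con 1ℚ :+ n) :* d := x :+ d :+ (s :+ n :* d)) refl (g a) d s n ⟩
      g a + d + (s + n * d)  ≡⟨ cong ((g a + d) +_) (∑-refine L) ⟩
      g a + d + (t + m * d)  ≡⟨ solve 4 (λ x d t m → x :+ d :+ (t :+ m :* d) := x :+ t :+ (con 1ℚ :+ m) :* d) refl (g a) d t m ⟩
      g a + t + (1ℚ + m) * d ∎
      where
      open ≡-Reasoning
      s = ∑ (filter P? L) h
      t = ∑ (filter Q? L) g
      n = ι (length (filter Q? L))
      m = ι (length (filter P? L))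

  -- Resampling the elements that were lost turns the uniform distribution on P into the one on Q.
  avg-refine : ∀ L → NonEmpty (filter Q? L) → {h g : A → ℚ} → (∀ {a} → Q a → h a ≡ g a) →
    (∀ {a} → P a → ¬ Q a → h a ≡ avg (filter Q? L) g) → avg (filter P? L) h ≡ avg (filter Q? L) g
  avg-refine L ne {h} {g} kept lost = begin
    inv m * s         ≡⟨ cong (inv m *_) s≡ ⟩
    inv m * (ι m * d) ≡⟨ sym (*-assoc (inv m) (ι m) d) ⟩
    inv m * ι m * d   ≡⟨ cong (_* d) (inv-ι⁺ (ℕₚ.≤-trans ne (length-filter-⊆ L))) ⟩
    1ℚ * d            ≡⟨ *-identityˡ d ⟩
    d ∎
    where
    open ≡-Reasoning
    n = length (filter Q? L)
    m = length (filter P? L)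
    d = avg (filter Q? L) g
    s = ∑ (filter P? L) h
    t = ∑ (filter Q? L) g
    nd≡t : ι n * d ≡ t
    nd≡t = trans (solve 3 (λ n i t → n :* (i :* t) := i :* n :* t) refl (ι n) (inv n) t)
      (trans (cong (_* t) (inv-ι⁺ ne)) (*-identityˡ t))
    -- As `d` is the average over `Q`, the term `ι n * d` equals `t`; the identity reads
    -- `s + t = t + ι m * d`, and `t` cancels.
    s≡ : s ≡ ι m * d
    s≡ = ∙-cancelˡ +-0-group t s (ι m * d) (trans (+-comm t s) (trans (cong (s +_) (sym nd≡t)) (∑-refine kept lost L)))

  -- `h` is the indicator of being lost, so this is the loss probability (m - n)/m; it is `∑-refine`
  -- with `d` = 1 and `g` = 0.
  avg-lost : ∀ L → NonEmpty (filter Q? L) → {h : A → ℚ} → (∀ {a} → Q a → h a ≡ 0ℚ) →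
    (∀ {a} → P a → ¬ Q a → h a ≡ 1ℚ) →
    avg (filter P? L) h ≡ 1ℚ - inv (length (filter P? L)) * ι (length (filter Q? L))
  avg-lost L ne {h} kept lost = begin
    i * s                         ≡⟨ solve 3 (λ i s n → i :* s := i :* (s :+ n :* con 1ℚ) :- i :* n) refl i s (ι n) ⟩
    i * (s + ι n * 1ℚ) - i * ι n  ≡⟨ cong (λ x → i * x - i * ι n) (∑-refine kept lost L) ⟩
    i * (z + ι m * 1ℚ) - i * ι n  ≡⟨ cong (λ x → i * (x + ι m * 1ℚ) - i * ι n) (trans (∑-const (filter Q? L) 0ℚ) (*-zeroʳ (ι n))) ⟩
    i * (0ℚ + ι m * 1ℚ) - i * ι n ≡⟨ solve 3 (λ i m n → i :* (con 0ℚ :+ m :* con 1ℚ) :- i :* n := i :* m :- i :* n) refl i (ι m) (ι n) ⟩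
    i * ι m - i * ι n             ≡⟨ cong (_- i * ι n) (inv-ι⁺ (ℕₚ.≤-trans ne (length-filter-⊆ L))) ⟩
    1ℚ - i * ι n ∎
    where
    open ≡-Reasoning
    n = length (filter Q? L)
    m = length (filter P? L)
    i = inv m
    s = ∑ (filter P? L) h
    z = ∑ (filter Q? L) (λ _ → 0ℚ)


-- Kraft families of feasible label sets

variable
  j k n : ℕ

-- An interval of level j together with the part of the service pattern below it:
-- its subintervals are listed newest first, and a level-0 interval is a single request.
data Tree (n : ℕ) : ℕ → Set where
  leaf : Fin n → Tree n zero
  node : Tree n j → List (Tree n j) → Tree n (suc j)

-- Levels 1 … j can be labelled so as to serve every request of the interval outside C.
Good : Tree n j → List (Fin n) → Set
Good {j = zero}  (leaf σ)    C = σ ∈ C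
Good {j = suc j} (node J Js) C = ∃[ b ] All (λ K → Good K (b ∷ C)) (J ∷ Js)

Fits : List (Tree n j) → List (Fin n) → Set
Fits Js C = All (λ K → Good K C) Js

good? : (J : Tree n j) (C : List (Fin n)) → Dec (Good J C)
good? {j = zero}  (leaf σ)    C = Any.any? (σ Finₚ.≟_) C
good? {j = suc j} (node J Js) C = Finₚ.any? (λ b → All.all? (λ K → good? K (b ∷ C)) (J ∷ Js))

fits? : (Js : List (Tree n j)) (C : List (Fin n)) → Dec (Fits Js C)
fits? Js C = All.all? (λ K → good? K C) Js

∷-mono : ∀ {b : Fin n} {C D} → C ⊆ D → b ∷ C ⊆ b ∷ D
∷-mono C⊆D (here e)  = here e
∷-mono C⊆D (there m) = there (C⊆D m)

good-mono : ∀ (J : Tree n j) {C D} → C ⊆ D → Good J C → Good J D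
good-mono {j = zero}  (leaf σ)    C⊆D m       = C⊆D m
good-mono {j = suc j} (node J Js) C⊆D (b , g) = b , All.map (λ {K} → good-mono K (∷-mono C⊆D)) g

fits-mono : ∀ {Js : List (Tree n j)} {C D} → C ⊆ D → Fits Js C → Fits Js D
fits-mono C⊆D = All.map (λ {K} → good-mono K C⊆D)

pow : ℚ → ℕ → ℚ
pow z zero    = 1ℚ
pow z (suc m) = z * pow z m

pow-+ : ∀ z m k → pow z (m ℕ.+ k) ≡ pow z m * pow z k
pow-+ z zero    k = sym (*-identityˡ (pow z k))
pow-+ z (suc m) k = trans (cong (z *_) (pow-+ z m k)) (sym (*-assoc z (pow z m) (pow z k)))

pow-nonNeg : ∀ {z} → 0ℚ ≤ℚ z → ∀ m → 0ℚ ≤ℚ pow z m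
pow-nonNeg 0≤z zero    = 0≤1
pow-nonNeg 0≤z (suc m) = *-nonNeg 0≤z (pow-nonNeg 0≤z m)

-- Duplicate-freeness together with disjointness from `C`: `length T` is then the size of a set, and
-- deleting an entry really removes a point.
Fresh : List (Fin n) → List (Fin n) → Set
Fresh []      C = ⊤
Fresh (t ∷ T) C = t ∉ T ++ C × Fresh T C

fresh-++ : ∀ (S T C : List (Fin n)) → Fresh S (T ++ C) → Fresh T C → Fresh (S ++ T) C
fresh-++ []      T C _         fT = fT
fresh-++ (s ∷ S) T C (s∉ , fS) fT = (s∉ ∘ subst (s ∈_) (Listₚ.++-assoc S T C)) , fresh-++ S T C fS fT

Kraft : ℚ → List (List (Fin n)) → ℚ
Kraft z Ts = ∑ Ts (λ T → pow z (length T))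

-- The family consists of the `S` with `P (S ++ C)`. For monotone `P`, `sound` and `complete` say
-- that these are exactly the supersets of members of `gens`, which need not be minimal.
record Generators (z : ℚ) (P : List (Fin n) → Set) (C : List (Fin n)) : Set where
  field
    gens     : List (List (Fin n))
    sound    : All (λ T → P (T ++ C) × Fresh T C) gens
    complete : ∀ S → P (S ++ C) → Any (_⊆ S) gens
    kraft    : Kraft z gens ≤ℚ 1ℚ

open Generators

-- If `C` alone suffices, the empty set generates everything, and its weight is 1 for every `z`.
unit-generators : ∀ {z} {P : List (Fin n) → Set} {C} → P C → Generators z P C
unit-generators p = record
  { gens = [] ∷ [] ; sound = (p , tt) ∷ [] ; complete = λ S _ → here λ () ; kraft = ≤-reflexive (+-identityʳ 1ℚ) }

module _ {z : ℚ} (0≤z : 0ℚ ≤ℚ z) (gen : (J : Tree n j) (C : List (Fin n)) → Generators z (Good J) C) where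

  -- Each generator `T` of the first interval is extended by the generators `U` of the remaining
  -- ones relative to `T ++ C`. Lengths add, so the extensions of `T` together weigh at most the
  -- weight of `T`.
  fits-generators : (Js : List (Tree n j)) (C : List (Fin n)) → Generators z (Fits Js) C
  fits-generators []       C = unit-generators []
  fits-generators (J ∷ Js) C = record
    { gens = concatMap step (gens G)
    ; sound = Allₚ.concat⁺ (Allₚ.map⁺ (All.map (λ {T} → step-sound T) (sound G)))
    ; complete = λ { S (p ∷ ps) → Anyₚ.concat⁺ (Anyₚ.map⁺ (Any.map (λ {T} → step-complete S ps T) (complete G S p))) }
    ; kraft = ≤-trans (≤-reflexive (∑-concatMap step (gens G) (λ T → pow z (length T))))
                (≤-trans (∑-mono-All (All.universal step-kraft (gens G))) (kraft G))
    }
    where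
    G = gen J C
    rest : (T : List (Fin n)) → Generators z (Fits Js) (T ++ C)
    rest T = fits-generators Js (T ++ C)
    step : List (Fin n) → List (List (Fin n))
    step T = map (_++ T) (gens (rest T))
    step-sound : ∀ T → Good J (T ++ C) × Fresh T C → All (λ U → Fits (J ∷ Js) (U ++ C) × Fresh U C) (step T)
    step-sound T (g , fT) = Allₚ.map⁺ (All.map (λ {U} (h , fU) →
        subst (Fits (J ∷ Js)) (sym (Listₚ.++-assoc U T C)) (good-mono J (∈-++⁺ʳ U) g ∷ h) , fresh-++ U T C fU fT)
      (sound (rest T)))
    step-complete : ∀ S → Fits Js (S ++ C) → ∀ T → T ⊆ S → Any (_⊆ S) (step T)
    step-complete S ps T T⊆S = Anyₚ.map⁺ (Any.map (λ {U} → join U)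
        -- Since `T ⊆ S`, the same `S` can be tested against the family relative to `T ++ C`.
        (complete (rest T) S (fits-mono (enlarge ∘ ∈-++⁻ S) ps)))
      where
      join : ∀ U → U ⊆ S → U ++ T ⊆ S
      join U U⊆S m with ∈-++⁻ U m
      ... | inj₁ m′ = U⊆S m′
      ... | inj₂ m′ = T⊆S m′
      enlarge : ∀ {x} → x ∈ S ⊎ x ∈ C → x ∈ S ++ (T ++ C)
      enlarge (inj₁ m) = ∈-++⁺ˡ m
      enlarge (inj₂ m) = ∈-++⁺ʳ S (∈-++⁺ʳ T m)
    step-kraft : ∀ T → Kraft z (step T) ≤ℚ pow z (length T)
    step-kraft T = begin
      Kraft z (step T)                                       ≡⟨ ∑-map (_++ T) (gens (rest T)) (λ U → pow z (length U)) ⟩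
      ∑ (gens (rest T)) (λ U → pow z (length (U ++ T)))      ≡⟨ ∑-cong (gens (rest T)) (λ U → trans (cong (pow z) (trans (Listₚ.length-++ U) (ℕₚ.+-comm (length U) (length T)))) (pow-+ z (length T) (length U))) ⟩
      ∑ (gens (rest T)) (λ U → pow z (length T) * pow z (length U)) ≡⟨ ∑-*ˡ (gens (rest T)) (pow z (length T)) (λ U → pow z (length U)) ⟩
      pow z (length T) * Kraft z (gens (rest T))             ≤⟨ *-monoʳ (pow-nonNeg 0≤z (length T)) (kraft (rest T)) ⟩
      pow z (length T) * 1ℚ                                  ≡⟨ *-identityʳ (pow z (length T)) ⟩
      pow z (length T) ∎
      where open ≤-Reasoning

-- Passing to the next level by deleting one element

removals : ∀ {A : Set} → List A → List (List A)
removals []      = []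
removals (t ∷ T) = T ∷ map (t ∷_) (removals T)

removals-sound : ∀ (T : List (Fin n)) → All (λ R → R ⊆ T × ∃[ b ] T ⊆ b ∷ R) (removals T)
removals-sound []      = []
removals-sound (t ∷ T) = (there , t , id) ∷ Allₚ.map⁺ (All.map (λ {R} → cons R) (removals-sound T))
  where
  cons : ∀ R → R ⊆ T × (∃[ b ] T ⊆ b ∷ R) → t ∷ R ⊆ t ∷ T × (∃[ b ] t ∷ T ⊆ b ∷ t ∷ R)
  cons R (R⊆T , b , T⊆bR) = ∷-mono R⊆T , b , swap
    where
    swap : t ∷ T ⊆ b ∷ t ∷ R
    swap (here e) = there (here e)
    swap (there m) with T⊆bR m
    ... | here e   = here e
    ... | there m′ = there (there m′)

removals-fresh : ∀ (T C : List (Fin n)) → Fresh T C → All (λ R → Fresh R C) (removals T)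
removals-fresh []      C f          = []
removals-fresh (t ∷ T) C (t∉ , f) = f ∷ Allₚ.map⁺ (All.zipWith
  (λ {R} (fR , R⊆T , _) → (t∉ ∘ shrink R R⊆T ∘ ∈-++⁻ R) , fR) (removals-fresh T C f , removals-sound T))
  where
  shrink : ∀ R → R ⊆ T → t ∈ R ⊎ t ∈ C → t ∈ T ++ C
  shrink R R⊆T (inj₁ m) = ∈-++⁺ˡ (R⊆T m)
  shrink R R⊆T (inj₂ m) = ∈-++⁺ʳ T m

-- The label `b` covers at most one element of a fresh list. If that is the head, freshness keeps
-- `b` out of the tail, so the tail lies in `S`. Otherwise the head stays and the search goes on; a
-- last remaining element is deleted even when it lies in `S`.
removals-complete : ∀ (t : Fin n) (T C : List (Fin n)) {b} {S} → Fresh (t ∷ T) C → t ∷ T ⊆ b ∷ S →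
                    Any (_⊆ S) (removals (t ∷ T))
removals-complete t T C {b} {S} (t∉ , f) sub with sub (here refl)
... | here refl = here (λ m → drop m (sub (there m)))
  where
  drop : ∀ {x} → x ∈ T → x ∈ b ∷ S → x ∈ S
  drop m (here refl) = ⊥-elim (t∉ (∈-++⁺ˡ m))
  drop m (there m′)  = m′
... | there t∈S = keep T f (λ m → sub (there m))
  where
  cons : ∀ R → R ⊆ S → t ∷ R ⊆ S
  cons R R⊆S (here refl) = t∈S
  cons R R⊆S (there m)   = R⊆S m
  keep : ∀ T → Fresh T C → T ⊆ b ∷ S → Any (_⊆ S) (removals (t ∷ T))
  keep []      _ _  = here λ ()
  keep (u ∷ T) f′ s = there (Anyₚ.map⁺ (Any.map (λ {R} → cons R)
                        (removals-complete u T C f′ s)))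

module _ {z : ℚ} (0≤z : 0ℚ ≤ℚ z) (z≤1 : z ≤ℚ 1ℚ) where

  private
    y : ℚ
    y = z * z * ½

    0≤y : 0ℚ ≤ℚ y
    0≤y = *-nonNeg (*-nonNeg 0≤z 0≤z) 0≤½

    shrink : ∀ {p} → 0ℚ ≤ℚ p → z * p ≤ℚ p
    shrink {p} 0≤p = ≤-trans (*-monoˡ 0≤p z≤1) (≤-reflexive (*-identityˡ p))

    -- The left side is z^(2s+2) / 2^(s+1), and surplus factors `z` and 1/2 are at most 1.
    pow-halves : ∀ s → pow y (suc s) ≤ℚ ½ * pow z (suc (suc s))
    pow-halves zero    = ≤-reflexive (solve 1 (λ z → z :* z :* con ½ :* con 1ℚ := con ½ :* (z :* (z :* con 1ℚ))) refl z)
    pow-halves (suc s) = begin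
      y * pow y (suc s)            ≤⟨ *-monoʳ 0≤y (pow-halves s) ⟩
      z * z * ½ * (½ * p)          ≡⟨ solve 2 (λ z p → z :* z :* con ½ :* (con ½ :* p) := con ½ :* con ½ :* (z :* (z :* p))) refl z p ⟩
      ½ * ½ * (z * (z * p))        ≤⟨ *-monoʳ (*-nonNeg 0≤½ 0≤½) (shrink (*-nonNeg 0≤z 0≤p)) ⟩
      ½ * ½ * (z * p)              ≤⟨ *-monoˡ (*-nonNeg 0≤z 0≤p) (≤-trans (≤-+ʳ {½ * ½} {½ * ½} (*-nonNeg 0≤½ 0≤½)) ≤-refl) ⟩
      ½ * (z * p) ∎
      where
      open ≤-Reasoning
      p = pow z (suc (suc s))
      0≤p = pow-nonNeg 0≤z (suc (suc s))

  -- A pair has two singleton removals, of total weight 2y = z²: this is where the 1/2 in `y` comes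
  -- from. For a larger set, deleting the head takes at most half of the weight, and the removals
  -- that keep the head take at most the other half by induction. A singleton would fail, its only
  -- removal having weight 1.
  removals-kraft : ∀ (t u : Fin n) T → Kraft (z * z * ½) (removals (t ∷ u ∷ T)) ≤ℚ pow z (length (t ∷ u ∷ T))
  removals-kraft t u [] = ≤-reflexive (solve 1 (λ z → z :* z :* con ½ :* con 1ℚ :+ (z :* z :* con ½ :* con 1ℚ :+ con 0ℚ) := z :* (z :* con 1ℚ)) refl z)
  removals-kraft t u (v ∷ T) = begin
    pow y (suc (suc (length T))) + ∑ (map (t ∷_) R) (λ U → pow y (length U)) ≡⟨ cong (pow y (suc (suc (length T))) +_) (trans (∑-map (t ∷_) R (λ U → pow y (length U))) (∑-*ˡ R y (λ U → pow y (length U)))) ⟩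
    pow y (suc (suc (length T))) + y * Kraft y R ≤⟨ +-mono-≤ (pow-halves (suc (length T))) (*-monoʳ 0≤y (removals-kraft u v T)) ⟩
    ½ * (z * p) + z * z * ½ * p      ≡⟨ solve 2 (λ z p → con ½ :* (z :* p) :+ z :* z :* con ½ :* p := con ½ :* (z :* p) :+ con ½ :* (z :* (z :* p))) refl z p ⟩
    ½ * (z * p) + ½ * (z * (z * p))  ≤⟨ +-monoʳ-≤ (½ * (z * p)) (*-monoʳ 0≤½ (shrink (*-nonNeg 0≤z 0≤p))) ⟩
    ½ * (z * p) + ½ * (z * p)        ≡⟨ solve 1 (λ x → con ½ :* x :+ con ½ :* x := x) refl (z * p) ⟩
    z * p ∎
    where
    open ≤-Reasoning
    R = removals (u ∷ v ∷ T)
    p = pow z (suc (suc (length T)))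
    0≤p = pow-nonNeg 0≤z (suc (suc (length T)))

  -- Either one label suffices over `C` and the empty set generates, or every generator has at least
  -- two elements, because a smaller one would be covered by a single label; then `removals-kraft`
  -- applies.
  node-generators : (J : Tree n j) (Js : List (Tree n j)) (C : List (Fin n)) →
    Generators z (Fits (J ∷ Js)) C → Generators (z * z * ½) (Good (node J Js)) C
  node-generators J Js C G with good? (node J Js) C
  ... | yes g = unit-generators g
  ... | no ¬g = record
    { gens = concatMap removals (gens G)
    ; sound = Allₚ.concat⁺ (Allₚ.map⁺ (All.map (λ {T} → step-sound T) (sound G)))
    ; complete = λ { S (b , p) → Anyₚ.concat⁺ (Anyₚ.map⁺ (step-complete b S (sound G) (complete G (b ∷ S) p))) }
    ; kraft = ≤-trans (≤-reflexive (∑-concatMap removals (gens G) (λ T → pow y (length T))))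
                (≤-trans (∑-mono-All (All.map (λ {T} → step-kraft T) (sound G))) (kraft G))
    }
    where
    Sound : List (Fin _) → Set
    Sound T = Fits (J ∷ Js) (T ++ C) × Fresh T C
    step-sound : ∀ T → Sound T → All (λ R → Good (node J Js) (R ++ C) × Fresh R C) (removals T)
    step-sound T (p , f) = All.zipWith (λ {R} ((_ , b , T⊆bR) , fR) →
        (b , fits-mono (enlarge R b T⊆bR ∘ ∈-++⁻ T) p) , fR) (removals-sound T , removals-fresh T C f)
      where
      enlarge : ∀ R b → T ⊆ b ∷ R → ∀ {x} → x ∈ T ⊎ x ∈ C → x ∈ b ∷ R ++ C
      enlarge R b s (inj₁ m) = ∈-++⁺ˡ {xs = b ∷ R} (s m)
      enlarge R b s (inj₂ m) = ∈-++⁺ʳ (b ∷ R) m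
    step-complete : ∀ b S {Ts} → All Sound Ts → Any (_⊆ b ∷ S) Ts → Any (λ T → Any (_⊆ S) (removals T)) Ts
    step-complete b S {[] ∷ _}      ((p , _) ∷ _) (here _)  = ⊥-elim (¬g (b , fits-mono there p))
    step-complete b S {(t ∷ T) ∷ _} ((_ , f) ∷ _) (here s)  = here (removals-complete t T C f s)
    step-complete b S               (_ ∷ ps)      (there a) = there (step-complete b S ps a)
    step-kraft : ∀ T → Sound T → Kraft y (removals T) ≤ℚ pow z (length T)
    step-kraft []          _       = 0≤1
    step-kraft (t ∷ [])    (p , _) = ⊥-elim (¬g (t , p))
    step-kraft (t ∷ u ∷ T) _       = removals-kraft t u T

-- The sequence 1, 1/2, 1/8, 1/128, ..., that is 2^(1 - 2^j).
ζ : ℕ → ℚ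
ζ zero    = 1ℚ
ζ (suc j) = ζ j * ζ j * ½

ζ-nonNeg : ∀ j → 0ℚ ≤ℚ ζ j
ζ-nonNeg zero    = 0≤1
ζ-nonNeg (suc j) = *-nonNeg (*-nonNeg (ζ-nonNeg j) (ζ-nonNeg j)) 0≤½

ζ≤1 : ∀ j → ζ j ≤ℚ 1ℚ
ζ≤1 zero    = ≤-refl
ζ≤1 (suc j) = begin
  ζ j * ζ j * ½ ≤⟨ *-monoˡ 0≤½ (*-monoʳ (ζ-nonNeg j) (ζ≤1 j)) ⟩
  ζ j * 1ℚ * ½  ≤⟨ *-monoˡ 0≤½ (*-monoˡ 0≤1 (ζ≤1 j)) ⟩
  ½             ≤⟨ ≤-+ʳ {½} {½} 0≤½ ⟩
  1ℚ ∎
  where open ≤-Reasoning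

good-generators : (J : Tree n j) (C : List (Fin n)) → Generators (ζ j) (Good J) C
good-generators {j = zero} (leaf σ) C with Any.any? (σ Finₚ.≟_) C
... | yes σ∈C = unit-generators σ∈C
-- A request outside `C` has the single generator consisting of `σ`, of weight `ζ 0` = 1.
... | no  σ∉C = record
  { gens = (σ ∷ []) ∷ [] ; sound = (here refl , σ∉C , tt) ∷ []
  ; complete = λ S m → here (λ { (here refl) → split S (∈-++⁻ S m) })
  ; kraft = ≤-refl }
  where
  split : ∀ S → σ ∈ S ⊎ σ ∈ C → σ ∈ S
  split S (inj₁ m) = m
  split S (inj₂ m) = ⊥-elim (σ∉C m)
good-generators {j = suc j} (node J Js) C =
  node-generators (ζ-nonNeg j) (ζ≤1 j) J Js C (fits-generators (ζ-nonNeg j) good-generators (J ∷ Js) C)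


-- The number of feasible labels and the harmonic potential

-- Distinct labels own distinct singletons, each of weight `z`; the induction strikes out one
-- singleton per label.
count-singletons : ∀ z (L : List (Fin n)) Ts → 0ℚ ≤ℚ z → Unique L → (∀ {b} → b ∈ L → b ∷ [] ∈ Ts) →
                   ι (length L) * z ≤ℚ Kraft z Ts
count-singletons z []      Ts 0≤z u        m = ≤-trans (≤-reflexive (*-zeroˡ z)) (∑-nonNeg Ts (λ T → pow-nonNeg 0≤z (length T)))
count-singletons z (b ∷ L) Ts 0≤z (b∉ ∷ u) m with ∈-∃++ (m (here refl))
... | A , B , refl = begin
  ι (suc (length L)) * z        ≡⟨ cong (_* z) (ι-suc (length L)) ⟩
  (1ℚ + ι (length L)) * z       ≡⟨ solve 2 (λ l z → (con 1ℚ :+ l) :* z := l :* z :+ z :* con 1ℚ) refl (ι (length L)) z ⟩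
  ι (length L) * z + z * 1ℚ     ≤⟨ +-monoˡ-≤ (z * 1ℚ) (count-singletons z L (A ++ B) 0≤z u rest) ⟩
  Kraft z (A ++ B) + z * 1ℚ     ≡⟨ cong (_+ z * 1ℚ) (∑-++ A B w) ⟩
  Kraft z A + Kraft z B + z * 1ℚ ≡⟨ solve 3 (λ a b z → a :+ b :+ z := a :+ (z :+ b)) refl (Kraft z A) (Kraft z B) (z * 1ℚ) ⟩
  Kraft z A + Kraft z ((b ∷ []) ∷ B) ≡⟨ sym (∑-++ A ((b ∷ []) ∷ B) w) ⟩
  Kraft z (A ++ (b ∷ []) ∷ B) ∎
  where
  open ≤-Reasoning
  w : List (Fin _) → ℚ
  w T = pow z (length T)
  rest : ∀ {c} → c ∈ L → c ∷ [] ∈ A ++ B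
  rest {c} c∈L with ∈-++⁻ A (m (there c∈L))
  ... | inj₁ i            = ∈-++⁺ˡ i
  ... | inj₂ (here refl)  = ⊥-elim (All.lookup b∉ c∈L refl)
  ... | inj₂ (there i)    = ∈-++⁺ʳ A i

labels : List (Tree n j) → List (Fin n) → List (Fin n)
labels {n} Js C = filter (λ b → fits? Js (b ∷ C)) (allFin n)

-- A feasible `b` gives the one-element member of the family, so some generator is contained in it.
-- The empty set is no generator since `C` alone does not fit; hence every feasible label
-- contributes a singleton of weight `ζ j`.
labels-count : (Js : List (Tree n j)) (C : List (Fin n)) → ¬ Fits Js C → ι (length (labels Js C)) * ζ j ≤ℚ 1ℚ
labels-count {n} {j} Js C ¬f = ≤-trans
  (count-singletons (ζ j) (labels Js C) (gens G) (ζ-nonNeg j) (Uniqueₚ.filter⁺ _ (Uniqueₚ.allFin⁺ n))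
    (λ {b} b∈ → singleton b (proj₂ (∈-filter⁻ (λ b → fits? Js (b ∷ C)) {xs = allFin n} b∈))))
  (kraft G)
  where
  G = fits-generators (ζ-nonNeg j) good-generators Js C
  only : ∀ {b} T → T ⊆ b ∷ [] → Fits Js (T ++ C) × Fresh T C → b ∷ [] ≡ T
  only []          s (f , _)        = ⊥-elim (¬f f)
  only (t ∷ [])    s _              with s (here refl)
  ... | here refl = refl
  -- Both entries would equal `b`, contradicting freshness.
  only (t ∷ u ∷ T) s (_ , t∉ , _)   with s (here refl) | s (there (here refl))
  ... | here refl | here refl = ⊥-elim (t∉ (here refl))
  singleton : ∀ b → Fits Js (b ∷ C) → b ∷ [] ∈ gens G
  singleton b f with find (complete G (b ∷ []) f)
  ... | T , T∈ , T⊆b = subst (_∈ gens G) (sym (only T T⊆b (All.lookup (sound G) T∈))) T∈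

-- By monotonicity nothing is excluded once `C` alone suffices. This is the only case outside
-- `labels-bound`.
labels-full : (Js : List (Tree n j)) (C : List (Fin n)) → Fits Js C → length (labels Js C) ≡ n
labels-full {n} Js C f = trans
  (cong length (Listₚ.filter-all (λ b → fits? Js (b ∷ C)) {xs = allFin n} (All.universal (λ b → fits-mono there f) (allFin n))))
  (Listₚ.length-tabulate id)

-- This is 2^j - 1, written as a doubling recursion to mirror the squaring in `ζ`; thus `bound j` is
-- the reciprocal of `ζ j`.
logBound : ℕ → ℕ
logBound zero    = 0
logBound (suc j) = suc (logBound j ℕ.+ logBound j)

bound : ℕ → ℕ
bound j = 2 ℕ.^ logBound j

suc-logBound : ∀ j → suc (logBound j) ≡ 2 ℕ.^ j
suc-logBound zero    = refl
suc-logBound (suc j) = trans (cong suc (sym (ℕₚ.+-suc (logBound j) (logBound j))))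
  (cong₂ ℕ._+_ (suc-logBound j) (trans (suc-logBound j) (sym (ℕₚ.+-identityʳ (2 ℕ.^ j)))))

bound-mono : ∀ {i j} → i ℕ.≤ j → bound i ℕ.≤ bound j
bound-mono {i} {j} i≤j = ℕₚ.^-monoʳ-≤ 2 (ℕ.s≤s⁻¹ (begin
  suc (logBound i) ≡⟨ suc-logBound i ⟩
  2 ℕ.^ i          ≤⟨ ℕₚ.^-monoʳ-≤ 2 i≤j ⟩
  2 ℕ.^ j          ≡⟨ sym (suc-logBound j) ⟩
  suc (logBound j) ∎))
  where open ℕₚ.≤-Reasoning

ζ-bound : ∀ j → ζ j * ι (bound j) ≡ 1ℚ
ζ-bound zero    = refl
ζ-bound (suc j) = begin
  ζ j * ζ j * ½ * ι (2 ℕ.* 2 ℕ.^ (e ℕ.+ e))           ≡⟨ cong (λ x → ζ j * ζ j * ½ * ι (2 ℕ.* x)) (ℕₚ.^-distribˡ-+-* 2 e e) ⟩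
  ζ j * ζ j * ½ * ι (2 ℕ.* (bound j ℕ.* bound j))     ≡⟨ cong (ζ j * ζ j * ½ *_) (trans (ι-* 2 (bound j ℕ.* bound j)) (cong (ι 2 *_) (ι-* (bound j) (bound j)))) ⟩
  ζ j * ζ j * ½ * (ι 2 * (y * y))                     ≡⟨ solve 2 (λ z y → z :* z :* con ½ :* (con (ι 2) :* (y :* y)) := (z :* y) :* (z :* y)) refl (ζ j) y ⟩
  (ζ j * y) * (ζ j * y)                               ≡⟨ cong₂ _*_ (ζ-bound j) (ζ-bound j) ⟩
  1ℚ ∎
  where
  open ≡-Reasoning
  e = logBound j
  y = ι (bound j)

labels-bound : (Js : List (Tree n j)) (C : List (Fin n)) → ¬ Fits Js C → length (labels Js C) ℕ.≤ bound j
labels-bound {n} {j} Js C ¬f = ι-cancel (begin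
  l                      ≡⟨ sym (*-identityʳ l) ⟩
  l * 1ℚ                 ≡⟨ cong (l *_) (sym (ζ-bound j)) ⟩
  l * (ζ j * y)          ≡⟨ sym (*-assoc l (ζ j) y) ⟩
  l * ζ j * y            ≤⟨ *-monoˡ (0≤ι (bound j)) (labels-count Js C ¬f) ⟩
  1ℚ * y                 ≡⟨ *-identityˡ y ⟩
  y ∎)
  where
  open ≤-Reasoning
  l = ι (length (labels Js C))
  y = ι (bound j)

harmonic : ℕ → ℚ
harmonic zero    = 0ℚ
harmonic (suc m) = harmonic m + inv (suc m)

harmonic-nonNeg : ∀ m → 0ℚ ≤ℚ harmonic m
harmonic-nonNeg zero    = ≤-refl
harmonic-nonNeg (suc m) = +-nonNeg (harmonic-nonNeg m) (0≤inv (suc m))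

harmonic-mono : ∀ {m n} → m ℕ.≤ n → harmonic m ≤ℚ harmonic n
harmonic-mono {m} m≤n with ℕₚ.m≤n⇒∃[o]m+o≡n m≤n
... | d , refl = go d
  where
  go : ∀ d → harmonic m ≤ℚ harmonic (m ℕ.+ d)
  go zero    rewrite ℕₚ.+-identityʳ m = ≤-refl
  go (suc d) rewrite ℕₚ.+-suc m d     = ≤-trans (go d) (≤-+ʳ (0≤inv (suc (m ℕ.+ d))))

-- Each of the `d` terms between the two harmonic numbers is at least the last one. The product on
-- the left is the probability of a loss when `suc m + d` labels shrink to `suc m`.
harmonic-lower : ∀ m d → ι d * inv (suc m ℕ.+ d) + harmonic (suc m) ≤ℚ harmonic (suc m ℕ.+ d)
harmonic-lower m zero    rewrite ℕₚ.+-identityʳ m = ≤-reflexive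
  (trans (cong (_+ harmonic (suc m)) (*-zeroˡ (inv (suc m)))) (+-identityˡ (harmonic (suc m))))
harmonic-lower m (suc d) rewrite ℕₚ.+-suc m d = begin
  ι (suc d) * i + h         ≡⟨ cong (λ x → x * i + h) (ι-suc d) ⟩
  (1ℚ + ι d) * i + h        ≡⟨ solve 3 (λ d i h → (con 1ℚ :+ d) :* i :+ h := d :* i :+ h :+ i) refl (ι d) i h ⟩
  ι d * i + h + i           ≤⟨ +-monoˡ-≤ i (+-monoˡ-≤ h (*-monoʳ (0≤ι d) (inv-anti (ℕₚ.n≤1+n (m ℕ.+ d))))) ⟩
  ι d * inv (suc (m ℕ.+ d)) + h + i ≤⟨ +-monoˡ-≤ i (harmonic-lower m d) ⟩
  harmonic (suc (m ℕ.+ d)) + i ∎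
  where
  open ≤-Reasoning
  i = inv (suc (suc (m ℕ.+ d)))
  h = harmonic (suc m)

-- Each of the `d` additional terms is at most the first one.
harmonic-upper : ∀ m d → harmonic (m ℕ.+ d) ≤ℚ harmonic m + ι d * inv (suc m)
harmonic-upper m zero    = ≤-trans (≤-reflexive (cong harmonic (ℕₚ.+-identityʳ m))) (≤-+ʳ (*-nonNeg (0≤ι 0) (0≤inv (suc m))))
harmonic-upper m (suc d) rewrite ℕₚ.+-suc m d = begin
  harmonic (m ℕ.+ d) + inv (suc (m ℕ.+ d)) ≤⟨ +-mono-≤ (harmonic-upper m d) (inv-anti (ℕₚ.m≤m+n m d)) ⟩
  harmonic m + ι d * i + i                 ≡⟨ solve 3 (λ h d i → h :+ d :* i :+ i := h :+ (con 1ℚ :+ d) :* i) refl (harmonic m) (ι d) i ⟩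
  harmonic m + (1ℚ + ι d) * i              ≡⟨ cong (λ x → harmonic m + x * i) (sym (ι-suc d)) ⟩
  harmonic m + ι (suc d) * i ∎
  where
  open ≤-Reasoning
  i = inv (suc m)

harmonic-double : ∀ m → harmonic (m ℕ.+ m) ≤ℚ 1ℚ + harmonic m
harmonic-double m = begin
  harmonic (m ℕ.+ m)              ≤⟨ harmonic-upper m m ⟩
  harmonic m + ι m * inv (suc m)  ≤⟨ +-monoʳ-≤ (harmonic m) (*-monoˡ (0≤inv (suc m)) (ι-mono (ℕₚ.n≤1+n m))) ⟩
  harmonic m + ι (suc m) * inv (suc m) ≡⟨ cong (harmonic m +_) (trans (*-comm (ι (suc m)) (inv (suc m))) (inv-ι m)) ⟩
  harmonic m + 1ℚ                 ≡⟨ +-comm (harmonic m) 1ℚ ⟩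
  1ℚ + harmonic m ∎
  where open ≤-Reasoning

harmonic-2^ : ∀ e → harmonic (2 ℕ.^ e) ≤ℚ ι (suc e)
harmonic-2^ zero    = ≤-refl
harmonic-2^ (suc e) rewrite ℕₚ.+-identityʳ (2 ℕ.^ e) | ι-suc (suc e) =
  ≤-trans (harmonic-double (2 ℕ.^ e)) (+-monoʳ-≤ 1ℚ (harmonic-2^ e))

-- Expected number of moves while the set of feasible labels shrinks from m elements;
-- a set of more than Y elements is the whole space, and one move is paid for leaving it.
φ : ℕ → ℕ → ℚ
φ Y m with m ≤? Y
... | yes _ = harmonic m
... | no  _ = 1ℚ + harmonic Y

φ-nonNeg : ∀ Y m → 0ℚ ≤ℚ φ Y m
φ-nonNeg Y m with m ≤? Y
... | yes _ = harmonic-nonNeg m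
... | no  _ = +-nonNeg 0≤1 (harmonic-nonNeg Y)

φ≤ : ∀ Y m → φ Y m ≤ℚ 1ℚ + harmonic Y
φ≤ Y m with m ≤? Y
... | yes m≤Y = ≤-trans (harmonic-mono m≤Y) (≤-+ˡ 0≤1)
... | no  _   = ≤-refl

-- With both sizes at most `Y`, the loss probability (m - m′)/m is at most H(m) - H(m′). When the
-- size drops from above `Y`, the extra 1 in `φ` pays for a probability of at most 1. When `m′` is
-- still above `Y`, nothing is lost because `m′ ≡ m`.
φ-step : ∀ Y m′ m → 1 ℕ.≤ m′ → m′ ℕ.≤ m → (Y ℕ.< m′ → m′ ≡ m) →
         (1ℚ - inv m * ι m′) + φ Y m′ ≤ℚ φ Y m
φ-step Y m′@(suc p) m (s≤s _) m′≤m full with m′ ≤? Y | m ≤? Y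
... | no  m′≰Y | yes m≤Y = ⊥-elim (m′≰Y (ℕₚ.≤-trans m′≤m m≤Y))
... | no  m′≰Y | no  m≰Y rewrite sym (full (ℕₚ.≰⇒> m′≰Y)) | inv-ι p = ≤-reflexive (+-identityˡ (1ℚ + harmonic Y))
... | yes m′≤Y | no  m≰Y = +-mono-≤ (≤-trans (≤-+ʳ {1ℚ - inv m * ι m′} (*-nonNeg (0≤inv m) (0≤ι m′)))
      (≤-reflexive (solve 1 (λ x → con 1ℚ :- x :+ x := con 1ℚ) refl (inv m * ι m′)))) (harmonic-mono m′≤Y)
... | yes m′≤Y | yes m≤Y with ℕₚ.m≤n⇒∃[o]m+o≡n m′≤m
...   | d , refl = ≤-trans (+-monoˡ-≤ (harmonic m′) (≤-reflexive lost)) (harmonic-lower p d)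
  where
  open ≡-Reasoning
  i = inv (m′ ℕ.+ d)
  lost : 1ℚ - i * ι m′ ≡ ι d * i
  lost = begin
    1ℚ - i * ι m′                ≡⟨ cong (_- i * ι m′) (sym (inv-ι (p ℕ.+ d))) ⟩
    i * ι (m′ ℕ.+ d) - i * ι m′  ≡⟨ cong (λ x → i * x - i * ι m′) (ι-+ m′ d) ⟩
    i * (ι m′ + ι d) - i * ι m′  ≡⟨ solve 3 (λ i m d → i :* (m :+ d) :- i :* m := d :* i) refl i (ι m′) (ι d) ⟩
    ι d * i ∎


-- Sampling labels

E : ∀ {X : Set} → List (ℚ × X) → (X → ℚ) → ℚ
E d f = ∑ d (λ pc → proj₁ pc * f (proj₂ pc))

E-cong : ∀ {X : Set} (d : List (ℚ × X)) {f g : X → ℚ} → (∀ x → f x ≡ g x) → E d f ≡ E d g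
E-cong d e = ∑-cong d (λ pc → cong (proj₁ pc *_) (e (proj₂ pc)))

E-+ : ∀ {X : Set} (d : List (ℚ × X)) (f g : X → ℚ) → E d (λ x → f x + g x) ≡ E d f + E d g
E-+ d f g = trans (∑-cong d (λ pc → *-distribˡ-+ (proj₁ pc) (f (proj₂ pc)) (g (proj₂ pc))))
  (∑-+ d (λ pc → proj₁ pc * f (proj₂ pc)) (λ pc → proj₁ pc * g (proj₂ pc)))

E-map : ∀ {X Y : Set} (h : X → Y) (d : List (ℚ × X)) (f : Y → ℚ) →
        E (map (λ pc → proj₁ pc , h (proj₂ pc)) d) f ≡ E d (f ∘ h)
E-map h d f = ∑-map (λ pc → proj₁ pc , h (proj₂ pc)) d (λ pc → proj₁ pc * f (proj₂ pc))

prefix : Fin n → List (ℚ × Vec (Fin n) j) → List (ℚ × Vec (Fin n) (suc j))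
prefix a = map (λ pc → proj₁ pc , a ∷ proj₂ pc)

uniform : List (Fin n) → (Fin n → List (ℚ × Vec (Fin n) j)) → List (ℚ × Vec (Fin n) (suc j))
uniform F g = concatMap (λ b → map (λ pc → inv (length F) * proj₁ pc , b ∷ proj₂ pc) (g b)) F

E-uniform : ∀ (F : List (Fin n)) (g : Fin n → List (ℚ × Vec (Fin n) j)) f →
            E (uniform F g) f ≡ avg F (λ b → E (g b) (λ v → f (b ∷ v)))
E-uniform F g f = begin
  E (uniform F g) f                          ≡⟨ ∑-concatMap (λ b → map (scaled b) (g b)) F weighted ⟩
  ∑ F (λ b → ∑ (map (scaled b) (g b)) weighted) ≡⟨ ∑-cong F (λ b → trans (∑-map (scaled b) (g b) weighted) (trans (∑-cong (g b) (λ pc → *-assoc i (proj₁ pc) (f (b ∷ proj₂ pc)))) (∑-*ˡ (g b) i (λ pc → proj₁ pc * f (b ∷ proj₂ pc))))) ⟩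
  ∑ F (λ b → i * E (g b) (λ v → f (b ∷ v))) ≡⟨ ∑-*ˡ F i (λ b → E (g b) (λ v → f (b ∷ v))) ⟩
  avg F (λ b → E (g b) (λ v → f (b ∷ v))) ∎
  where
  open ≡-Reasoning
  i = inv (length F)
  scaled : Fin _ → ℚ × Vec (Fin _) _ → ℚ × Vec (Fin _) _
  scaled b pc = i * proj₁ pc , b ∷ proj₂ pc
  weighted : ℚ × Vec (Fin _) _ → ℚ
  weighted pc = proj₁ pc * f (proj₂ pc)

-- Only the newest interval of each level carries a server, so sampling descends into `J` alone; the
-- older `Js` merely restrict the choice of the label.
draw : Tree n j → List (Fin n) → List (ℚ × Vec (Fin n) j)
draw (leaf σ)    C = (1ℚ , []) ∷ []
draw (node J Js) C = uniform (labels (J ∷ Js) C) (λ b → draw J (b ∷ C))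

-- Levels up to `ρ` have just begun new intervals and are sampled afresh. A higher level keeps its
-- label while that is feasible; losing it discards everything below as well.
redraw : ℕ → Tree n j → List (Fin n) → Vec (Fin n) j → List (ℚ × Vec (Fin n) j)
redraw ρ (leaf σ)            C []      = draw (leaf σ) C
redraw ρ (node {j = j} J Js) C (a ∷ v) with suc j ≤? ρ | fits? (J ∷ Js) (a ∷ C)
... | no _ | yes _ = prefix a (redraw ρ J (a ∷ C) v)
... | _    | _     = draw (node J Js) C

redraw-renew : ∀ {ρ} (J : Tree n j) C v → j ℕ.≤ ρ → redraw ρ J C v ≡ draw J C
redraw-renew         (leaf σ)            C []      _   = refl
redraw-renew {ρ = ρ} (node {j = j} J Js) C (a ∷ v) j≤ρ with suc j ≤? ρ | fits? (J ∷ Js) (a ∷ C)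
... | yes _   | _     = refl
... | no  j≰ρ | _     = ⊥-elim (j≰ρ j≤ρ)

redraw-kept : ∀ {ρ} (J : Tree n j) Js C a v → ¬ suc j ℕ.≤ ρ → Fits (J ∷ Js) (a ∷ C) →
              redraw ρ (node J Js) C (a ∷ v) ≡ prefix a (redraw ρ J (a ∷ C) v)
redraw-kept {j = j} {ρ} J Js C a v j≰ρ f with suc j ≤? ρ | fits? (J ∷ Js) (a ∷ C)
... | yes j≤ρ | _     = ⊥-elim (j≰ρ j≤ρ)
... | no  _   | yes _ = refl
... | no  _   | no ¬f = ⊥-elim (¬f f)

redraw-lost : ∀ ρ (J : Tree n j) Js C a v → ¬ Fits (J ∷ Js) (a ∷ C) →
              redraw ρ (node J Js) C (a ∷ v) ≡ draw (node J Js) C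
redraw-lost {j = j} ρ J Js C a v ¬f with suc j ≤? ρ | fits? (J ∷ Js) (a ∷ C)
... | yes _ | _     = refl
... | no  _ | yes f = ⊥-elim (¬f f)
... | no  _ | no  _ = refl

labels-feasible : ∀ (Js : List (Tree n j)) C → All (λ b → Fits Js (b ∷ C)) (labels Js C)
labels-feasible {n} Js C = Allₚ.all-filter (λ b → fits? Js (b ∷ C)) (allFin n)

labels-nonEmpty : ∀ (J : Tree n j) Js C → Good (node J Js) C → NonEmpty (labels (J ∷ Js) C)
labels-nonEmpty J Js C (b , f) = ∈-length (∈-filter⁺ (λ b → fits? (J ∷ Js) (b ∷ C)) (∈-allFin b) f)

E-draw-mono : ∀ (J : Tree n j) C {f g : Vec (Fin n) j → ℚ} → (∀ v → f v ≤ℚ g v) → E (draw J C) f ≤ℚ E (draw J C) g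
E-draw-mono (leaf σ)    C le = +-monoˡ-≤ 0ℚ (*-monoʳ 0≤1 (le []))
E-draw-mono (node J Js) C {f} {g} le = begin
  E (draw (node J Js) C) f                                ≡⟨ E-uniform F (λ b → draw J (b ∷ C)) f ⟩
  avg F (λ b → E (draw J (b ∷ C)) (λ v → f (b ∷ v)))      ≤⟨ avg-mono-All (All.universal (λ b → E-draw-mono J (b ∷ C) (λ v → le (b ∷ v))) F) ⟩
  avg F (λ b → E (draw J (b ∷ C)) (λ v → g (b ∷ v)))      ≡⟨ sym (E-uniform F (λ b → draw J (b ∷ C)) g) ⟩
  E (draw (node J Js) C) g ∎
  where
  open ≤-Reasoning
  F = labels (J ∷ Js) C

-- Goodness makes every label set met on the way down nonempty, so the total mass is 1.
E-draw-const : ∀ (J : Tree n j) C → Good J C → (c : ℚ) → E (draw J C) (λ _ → c) ≡ c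
E-draw-const (leaf σ)    C g c = trans (+-identityʳ (1ℚ * c)) (*-identityˡ c)
E-draw-const (node J Js) C g c = begin
  E (draw (node J Js) C) (λ _ → c)             ≡⟨ E-uniform F (λ b → draw J (b ∷ C)) (λ _ → c) ⟩
  avg F (λ b → E (draw J (b ∷ C)) (λ _ → c))   ≡⟨ avg-cong-All (All.map (λ { {b} (g′ ∷ _) → E-draw-const J (b ∷ C) g′ c }) (labels-feasible (J ∷ Js) C)) ⟩
  avg F (λ _ → c)                              ≡⟨ avg-const F (labels-nonEmpty J Js C g) c ⟩
  c ∎
  where
  open ≡-Reasoning
  F = labels (J ∷ Js) C

-- All that the analysis uses about one round: a renewed interval may change arbitrarily, while a
-- continuing one gains constraints, so its feasible label sets shrink.
data Step (ρ : ℕ) {n : ℕ} : ∀ {j} → Tree n j → Tree n j → Set where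
  renew : {J J′ : Tree n j} → j ℕ.≤ ρ → Step ρ J J′
  keep  : {J J′ : Tree n j} {Js Js′ : List (Tree n j)} → ¬ suc j ℕ.≤ ρ → Step ρ J J′ →
          (∀ {D} → Fits (J′ ∷ Js′) D → Fits (J ∷ Js) D) → Step ρ (node J Js) (node J′ Js′)

-- A renewed interval is drawn independently of the past. For a continuing one, `avg-refine` handles
-- the top label: under a surviving label the induction hypothesis applies, and a lost label
-- triggers a fresh draw.
redraw-stationary : ∀ {ρ} {J J′ : Tree n j} → Step ρ J J′ → ∀ C → Good J C → Good J′ C → (f : Vec (Fin n) j → ℚ) →
  E (draw J C) (λ v → E (redraw ρ J′ C v) f) ≡ E (draw J′ C) f
redraw-stationary {ρ = ρ} {J} {J′} (renew j≤ρ) C g g′ f = trans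
  (E-cong (draw J C) (λ v → cong (λ d → E d f) (redraw-renew J′ C v j≤ρ))) (E-draw-const J C g (E (draw J′ C) f))
redraw-stationary {n = n} {ρ = ρ} {node J Js} {node J′ Js′} (keep j≰ρ st sub) C g g′ f = begin
  E (draw (node J Js) C) (λ v → E (redraw ρ (node J′ Js′) C v) f)
    ≡⟨ E-uniform (labels (J ∷ Js) C) (λ b → draw J (b ∷ C)) _ ⟩
  avg (labels (J ∷ Js) C) (λ a → E (draw J (a ∷ C)) (λ v → E (redraw ρ (node J′ Js′) C (a ∷ v)) f))
    ≡⟨ avg-refine (λ b → fits? (J ∷ Js) (b ∷ C)) (λ b → fits? (J′ ∷ Js′) (b ∷ C)) sub (allFin n)
         (labels-nonEmpty J′ Js′ C g′) kept lost ⟩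
  avg (labels (J′ ∷ Js′) C) after
    ≡⟨ sym (E-uniform (labels (J′ ∷ Js′) C) (λ b → draw J′ (b ∷ C)) f) ⟩
  E (draw (node J′ Js′) C) f ∎
  where
  open ≡-Reasoning
  after : Fin n → ℚ
  after b = E (draw J′ (b ∷ C)) (λ v → f (b ∷ v))
  kept : ∀ {a} → Fits (J′ ∷ Js′) (a ∷ C) → E (draw J (a ∷ C)) (λ v → E (redraw ρ (node J′ Js′) C (a ∷ v)) f) ≡ after a
  kept {a} q = trans
    (E-cong (draw J (a ∷ C)) (λ v → trans (cong (λ d → E d f) (redraw-kept J′ Js′ C a v j≰ρ q))
      (E-map (a ∷_) (redraw ρ J′ (a ∷ C) v) f)))
    (redraw-stationary st (a ∷ C) (All.head (sub q)) (All.head q) (λ v → f (a ∷ v)))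
  lost : ∀ {a} → Fits (J ∷ Js) (a ∷ C) → ¬ Fits (J′ ∷ Js′) (a ∷ C) →
         E (draw J (a ∷ C)) (λ v → E (redraw ρ (node J′ Js′) C (a ∷ v)) f) ≡ avg (labels (J′ ∷ Js′) C) after
  lost {a} p ¬q = trans
    (E-cong (draw J (a ∷ C)) (λ v → cong (λ d → E d f) (redraw-lost ρ J′ Js′ C a v ¬q)))
    (trans (E-draw-const J (a ∷ C) (All.head p) _) (E-uniform (labels (J′ ∷ Js′) C) (λ b → draw J′ (b ∷ C)) f))

-- Movement cost and the potential function

full : Vec ℚ j → ℚ
full []       = 0ℚ
full (w ∷ ws) = w + full ws

moved : Vec ℚ j → Vec (Fin n) j → Vec (Fin n) j → ℚ
moved []       []      []        = 0ℚ
moved (w ∷ ws) (a ∷ v) (a′ ∷ v′) = (if ⌊ a Finₚ.≟ a′ ⌋ then 0ℚ else w) + moved ws v v′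

NonNegs : Vec ℚ j → Set
NonNegs = VAll.All (0ℚ ≤ℚ_)

moved≤full : ∀ {ws : Vec ℚ j} → NonNegs ws → ∀ (v v′ : Vec (Fin n) j) → moved ws v v′ ≤ℚ full ws
moved≤full []        []      []        = ≤-refl
moved≤full {ws = w ∷ ws} (p ∷ ps) (a ∷ v) (a′ ∷ v′) with a Finₚ.≟ a′
... | yes _ = +-mono-≤ p (moved≤full ps v v′)
... | no  _ = +-monoʳ-≤ w (moved≤full ps v v′)

-- `q` bounds the expected number of moves of one level per renewal: one for the renewal itself, and
-- at most 1 + H(Y) while its label set shrinks.
module Potential (Y : ℕ) (q : ℚ) (φ-q : 1ℚ + (1ℚ + harmonic Y) ≤ℚ q) where

  0≤q : 0ℚ ≤ℚ q
  0≤q = ≤-trans (+-nonNeg 0≤1 (+-nonNeg 0≤1 (harmonic-nonNeg Y))) φ-q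

  -- restart bounds the whole future cost of the levels of ws from a fresh sample until the next renewal,
  -- so a move at the level above costs its own weight plus restart.
  restart : Vec ℚ j → ℚ
  restart []       = 0ℚ
  restart (w ∷ ws) = (w + restart ws) * q

  restart-nonNeg : ∀ {ws : Vec ℚ j} → NonNegs ws → 0ℚ ≤ℚ restart ws
  restart-nonNeg []       = ≤-refl
  restart-nonNeg (p ∷ ps) = *-nonNeg (+-nonNeg p (restart-nonNeg ps)) 0≤q

  -- `φ` bounds the expected number of future losses at this level, each costing `w + restart ws`.
  -- The potential below is averaged because the label is uniform.
  potential : Vec ℚ j → Tree n j → List (Fin n) → ℚ
  potential []       (leaf σ)    C = 0ℚ
  potential (w ∷ ws) (node J Js) C =
    (w + restart ws) * φ Y (length (labels (J ∷ Js) C)) + avg (labels (J ∷ Js) C) (λ b → potential ws J (b ∷ C))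

  potential-nonNeg : ∀ {ws : Vec ℚ j} → NonNegs ws → ∀ (J : Tree n j) C → 0ℚ ≤ℚ potential ws J C
  potential-nonNeg []       (leaf σ)    C = ≤-refl
  potential-nonNeg (p ∷ ps) (node J Js) C = +-nonNeg
    (*-nonNeg (+-nonNeg p (restart-nonNeg ps)) (φ-nonNeg Y (length (labels (J ∷ Js) C))))
    (avg-nonNeg (labels (J ∷ Js) C) (λ b → potential-nonNeg ps J (b ∷ C)))

  -- Moving everything and building up the potential below the top level costs at most `restart ws`.
  -- With the weight `w` this is one unit `w + restart ws`; the potential of the top level adds `φ`
  -- such units, and 1 + φ ≤ q.
  full+potential≤restart : ∀ {ws : Vec ℚ j} → NonNegs ws → ∀ (J : Tree n j) C → Good J C →
                           full ws + potential ws J C ≤ℚ restart ws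
  full+avg≤restart : ∀ {ws : Vec ℚ j} → NonNegs ws → ∀ (J : Tree n j) Js C → Good (node J Js) C →
                     full ws + avg (labels (J ∷ Js) C) (λ b → potential ws J (b ∷ C)) ≤ℚ restart ws

  full+avg≤restart {ws = ws} ps J Js C g = begin
    full ws + avg F pot                   ≡⟨ cong (_+ avg F pot) (sym (avg-const F (labels-nonEmpty J Js C g) (full ws))) ⟩
    avg F (λ _ → full ws) + avg F pot     ≡⟨ sym (avg-+ F (λ _ → full ws) pot) ⟩
    avg F (λ b → full ws + pot b)         ≤⟨ avg-mono-All (All.map (λ { {b} (g′ ∷ _) → full+potential≤restart ps J (b ∷ C) g′ }) (labels-feasible (J ∷ Js) C)) ⟩
    avg F (λ _ → restart ws)              ≡⟨ avg-const F (labels-nonEmpty J Js C g) (restart ws) ⟩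
    restart ws ∎
    where
    open ≤-Reasoning
    F = labels (J ∷ Js) C
    pot : Fin _ → ℚ
    pot b = potential ws J (b ∷ C)

  full+potential≤restart []                 (leaf σ)    C g = ≤-refl
  full+potential≤restart {ws = w ∷ ws} (p ∷ ps) (node J Js) C g = begin
    w + full ws + (B * f + a)   ≡⟨ solve 5 (λ w s B f a → w :+ s :+ (B :* f :+ a) := w :+ (s :+ a) :+ B :* f) refl w (full ws) B f a ⟩
    w + (full ws + a) + B * f   ≤⟨ +-monoˡ-≤ (B * f) (+-monoʳ-≤ w (full+avg≤restart ps J Js C g)) ⟩
    B + B * f                   ≡⟨ solve 2 (λ B f → B :+ B :* f := B :* (con 1ℚ :+ f)) refl B f ⟩
    B * (1ℚ + f)                ≤⟨ *-monoʳ (+-nonNeg p (restart-nonNeg ps)) (≤-trans (+-monoʳ-≤ 1ℚ (φ≤ Y m)) φ-q) ⟩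
    B * q ∎
    where
    open ≤-Reasoning
    B = w + restart ws
    m = length (labels (J ∷ Js) C)
    f = φ Y m
    a = avg (labels (J ∷ Js) C) (λ b → potential ws J (b ∷ C))

  -- Only the highest renewed level is charged, since its `restart` covers all levels below it.
  charge : ℕ → Vec ℚ j → ℚ
  charge ρ []                = 0ℚ
  charge ρ (_∷_ {n = j} w ws) with suc j ≤? ρ
  ... | yes _ = restart (w ∷ ws)
  ... | no  _ = charge ρ ws

  charge-renew : ∀ {ρ} (ws : Vec ℚ j) → j ℕ.≤ ρ → charge ρ ws ≡ restart ws
  charge-renew         []             _   = refl
  charge-renew {ρ = ρ} (_∷_ {n = j} w ws) j≤ρ with suc j ≤? ρ
  ... | yes _   = refl
  ... | no  j≰ρ = ⊥-elim (j≰ρ j≤ρ)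

  charge-keep : ∀ {ρ} w (ws : Vec ℚ j) → ¬ suc j ℕ.≤ ρ → charge ρ (w ∷ ws) ≡ charge ρ ws
  charge-keep {j} {ρ} w ws j≰ρ with suc j ≤? ρ
  ... | yes j≤ρ = ⊥-elim (j≰ρ j≤ρ)
  ... | no  _   = refl

  charge-nonNeg : ∀ ρ {ws : Vec ℚ j} → NonNegs ws → 0ℚ ≤ℚ charge ρ ws
  charge-nonNeg ρ []                         = ≤-refl
  charge-nonNeg {suc j} ρ (p ∷ ps) with suc j ≤? ρ
  ... | yes _ = restart-nonNeg (p ∷ ps)
  ... | no  _ = charge-nonNeg ρ ps

  E-moved≤full : ∀ {ws : Vec ℚ j} → NonNegs ws → ∀ (J : Tree n j) C → Good J C → ∀ v → E (draw J C) (moved ws v) ≤ℚ full ws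
  E-moved≤full {ws = ws} ps J C g v = ≤-trans (E-draw-mono J C (moved≤full ps v)) (≤-reflexive (E-draw-const J C g (full ws)))

  -- The amortised cost of a round. After a renewal, `full+potential≤restart` pays. Otherwise, below
  -- a surviving label the induction hypothesis pays, and each lost label costs at most `B`; the
  -- probability of a loss is paid by the decrease of `φ`.
  potential-step : ∀ {ρ} {ws : Vec ℚ j} → NonNegs ws → bound j ℕ.≤ Y →
    {J J′ : Tree n j} → Step ρ J J′ → ∀ C → Good J C → Good J′ C →
    E (draw J C) (λ v → E (redraw ρ J′ C v) (moved ws v)) + potential ws J′ C ≤ℚ potential ws J C + charge ρ ws
  potential-step {ρ = ρ} {ws} ps _ {J} {J′} (renew j≤ρ) C g g′ = begin
    E (draw J C) (λ v → E (redraw ρ J′ C v) (moved ws v)) + potential ws J′ C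
      ≤⟨ +-monoˡ-≤ _ (E-draw-mono J C (λ v → ≤-trans (≤-reflexive (cong (λ d → E d (moved ws v)) (redraw-renew J′ C v j≤ρ))) (E-moved≤full ps J′ C g′ v))) ⟩
    E (draw J C) (λ _ → full ws) + potential ws J′ C
      ≡⟨ cong (_+ potential ws J′ C) (E-draw-const J C g (full ws)) ⟩
    full ws + potential ws J′ C      ≤⟨ full+potential≤restart ps J′ C g′ ⟩
    restart ws                       ≡⟨ sym (charge-renew ws j≤ρ) ⟩
    charge ρ ws                      ≤⟨ ≤-+ˡ (potential-nonNeg ps J C) ⟩
    potential ws J C + charge ρ ws ∎
    where open ≤-Reasoning
  potential-step {suc j} {n = n} {ρ = ρ} {w ∷ ws} (p ∷ ps) bY {node J Js} {node J′ Js′} (keep j≰ρ st sub) C g g′ = begin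
    E (draw (node J Js) C) (λ v → E (redraw ρ (node J′ Js′) C v) (moved (w ∷ ws) v)) + (B * φ Y m′ + P′)
      ≡⟨ cong (_+ (B * φ Y m′ + P′)) (E-uniform F (λ b → draw J (b ∷ C)) _) ⟩
    avg F M + (B * φ Y m′ + P′)
      ≡⟨ solve 3 (λ x y z → x :+ (y :+ z) := (x :+ z) :+ y) refl (avg F M) (B * φ Y m′) P′ ⟩
    (avg F M + P′) + B * φ Y m′
      ≡⟨ cong (λ x → (avg F M + x) + B * φ Y m′) (sym avg-h) ⟩
    (avg F M + avg F h) + B * φ Y m′
      ≡⟨ cong (_+ B * φ Y m′) (sym (avg-+ F M h)) ⟩
    avg F (λ a → M a + h a) + B * φ Y m′
      ≤⟨ +-monoˡ-≤ (B * φ Y m′) (avg-mono-All (All.map (λ {a} → pointwise a) (labels-feasible (J ∷ Js) C))) ⟩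
    avg F (λ a → (pot a + c) + B * u a) + B * φ Y m′
      ≡⟨ cong (_+ B * φ Y m′) avg-split ⟩
    (avg F pot + c + B * (1ℚ - inv m * ι m′)) + B * φ Y m′
      ≡⟨ solve 5 (λ x c B t f → (x :+ c :+ B :* t) :+ B :* f := B :* (t :+ f) :+ x :+ c) refl (avg F pot) c B (1ℚ - inv m * ι m′) (φ Y m′) ⟩
    B * ((1ℚ - inv m * ι m′) + φ Y m′) + avg F pot + c
      ≤⟨ +-monoˡ-≤ c (+-monoˡ-≤ (avg F pot) (*-monoʳ 0≤B
           (φ-step Y m′ m (labels-nonEmpty J′ Js′ C g′) (length-filter-⊆ P? Q? sub (allFin n)) m′-full))) ⟩
    B * φ Y m + avg F pot + c ∎
    where
    open ≤-Reasoning
    P? = λ (b : Fin n) → fits? (J ∷ Js) (b ∷ C)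
    Q? = λ (b : Fin n) → fits? (J′ ∷ Js′) (b ∷ C)
    F  = labels (J ∷ Js) C
    F′ = labels (J′ ∷ Js′) C
    m  = length F
    m′ = length F′
    B  = w + restart ws
    c  = charge ρ (w ∷ ws)
    0≤B : 0ℚ ≤ℚ B
    0≤B = +-nonNeg p (restart-nonNeg ps)
    pot pot′ M h u : Fin n → ℚ
    pot a  = potential ws J (a ∷ C)
    pot′ a = potential ws J′ (a ∷ C)
    P′ = avg F′ pot′
    M a = E (draw J (a ∷ C)) (λ v → E (redraw ρ (node J′ Js′) C (a ∷ v)) (moved (w ∷ ws) (a ∷ v)))
    -- The new average `P′` is rewritten over the old labels, so that both sides can be compared
    -- label by label; `u` marks the lost labels.
    h a = if does (Q? a) then pot′ a else P′
    u a = if does (Q? a) then 0ℚ else 1ℚ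

    if-yes : ∀ {a} {x y : ℚ} → Fits (J′ ∷ Js′) (a ∷ C) → (if does (Q? a) then x else y) ≡ x
    if-yes {a} q rewrite dec-true (Q? a) q = refl
    if-no : ∀ {a} {x y : ℚ} → ¬ Fits (J′ ∷ Js′) (a ∷ C) → (if does (Q? a) then x else y) ≡ y
    if-no {a} ¬q rewrite dec-false (Q? a) ¬q = refl

    avg-h : avg F h ≡ P′
    avg-h = avg-refine P? Q? sub (allFin n) (labels-nonEmpty J′ Js′ C g′) if-yes (λ _ → if-no)

    avg-split : avg F (λ a → (pot a + c) + B * u a) ≡ avg F pot + c + B * (1ℚ - inv m * ι m′)
    avg-split = trans (avg-+ F (λ a → pot a + c) (λ a → B * u a)) (cong₂ _+_
      (trans (avg-+ F pot (λ _ → c)) (cong (avg F pot +_) (avg-const F (labels-nonEmpty J Js C g) c)))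
      (trans (avg-*ˡ F B u) (cong (B *_) (avg-lost P? Q? sub (allFin n) (labels-nonEmpty J′ Js′ C g′) if-yes (λ _ → if-no)))))

    -- A label set larger than `Y` arises only when `C` alone suffices, now and hence also before
    -- the round; both sets are then the whole space.
    m′-full : Y ℕ.< m′ → m′ ≡ m
    m′-full Y<m′ with fits? (J′ ∷ Js′) C
    ... | yes f = trans (labels-full (J′ ∷ Js′) C f) (sym (labels-full (J ∷ Js) C (sub f)))
    ... | no ¬f = ⊥-elim (ℕₚ.<⇒≱ Y<m′ (ℕₚ.≤-trans (labels-bound (J′ ∷ Js′) C ¬f) (ℕₚ.≤-trans (bound-mono (ℕₚ.n≤1+n j)) bY)))

    moved-same : ∀ a v v′ → moved (w ∷ ws) (a ∷ v) (a ∷ v′) ≡ moved ws v v′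
    moved-same a v v′ with a Finₚ.≟ a
    ... | yes _  = +-identityˡ (moved ws v v′)
    ... | no a≢a = ⊥-elim (a≢a refl)

    kept : ∀ a → Fits (J′ ∷ Js′) (a ∷ C) → M a + pot′ a ≤ℚ pot a + c
    kept a q = begin
      M a + pot′ a
        ≡⟨ cong (_+ pot′ a) (E-cong (draw J (a ∷ C)) (λ v → trans
             (cong (λ d → E d (moved (w ∷ ws) (a ∷ v))) (redraw-kept J′ Js′ C a v j≰ρ q))
             (trans (E-map (a ∷_) (redraw ρ J′ (a ∷ C) v) (moved (w ∷ ws) (a ∷ v)))
               (E-cong (redraw ρ J′ (a ∷ C) v) (moved-same a v))))) ⟩
      E (draw J (a ∷ C)) (λ v → E (redraw ρ J′ (a ∷ C) v) (moved ws v)) + pot′ a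
        ≤⟨ potential-step ps (ℕₚ.≤-trans (bound-mono (ℕₚ.n≤1+n j)) bY) st (a ∷ C) (All.head (sub q)) (All.head q) ⟩
      pot a + charge ρ ws
        ≡⟨ cong (pot a +_) (sym (charge-keep w ws j≰ρ)) ⟩
      pot a + c ∎

    -- In the worst case every server from this level down moves; together with the new potential
    -- below, this is one unit `B`.
    lost : ∀ a → Fits (J ∷ Js) (a ∷ C) → ¬ Fits (J′ ∷ Js′) (a ∷ C) → M a + P′ ≤ℚ B
    lost a f ¬q = begin
      M a + P′
        ≤⟨ +-monoˡ-≤ P′ (E-draw-mono J (a ∷ C) (λ v → ≤-trans
             (≤-reflexive (cong (λ d → E d (moved (w ∷ ws) (a ∷ v))) (redraw-lost ρ J′ Js′ C a v ¬q)))
             (E-moved≤full (p ∷ ps) (node J′ Js′) C g′ (a ∷ v)))) ⟩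
      E (draw J (a ∷ C)) (λ _ → w + full ws) + P′
        ≡⟨ cong (_+ P′) (E-draw-const J (a ∷ C) (All.head f) (w + full ws)) ⟩
      w + full ws + P′
        ≡⟨ +-assoc w (full ws) P′ ⟩
      w + (full ws + P′)
        ≤⟨ +-monoʳ-≤ w (full+avg≤restart ps J′ Js′ C g′) ⟩
      B ∎

    pointwise : ∀ a → Fits (J ∷ Js) (a ∷ C) → M a + h a ≤ℚ (pot a + c) + B * u a
    pointwise a f = cases (Q? a)
      where
      cases : Dec (Fits (J′ ∷ Js′) (a ∷ C)) → M a + h a ≤ℚ (pot a + c) + B * u a
      cases (yes q) = begin
        M a + h a              ≡⟨ cong (M a +_) (if-yes q) ⟩
        M a + pot′ a           ≤⟨ kept a q ⟩
        pot a + c              ≤⟨ ≤-+ʳ (≤-reflexive (sym (*-zeroʳ B))) ⟩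
        (pot a + c) + B * 0ℚ   ≡⟨ cong (λ x → (pot a + c) + B * x) (sym (if-yes q)) ⟩
        (pot a + c) + B * u a ∎
      cases (no ¬q) = begin
        M a + h a              ≡⟨ cong (M a +_) (if-no ¬q) ⟩
        M a + P′               ≤⟨ lost a f ¬q ⟩
        B                      ≡⟨ sym (*-identityʳ B) ⟩
        B * 1ℚ                 ≤⟨ ≤-+ˡ (+-nonNeg (potential-nonNeg ps J (a ∷ C)) (charge-nonNeg ρ (p ∷ ps))) ⟩
        (pot a + c) + B * 1ℚ   ≡⟨ cong (λ x → (pot a + c) + B * x) (sym (if-no ¬q)) ⟩
        (pot a + c) + B * u a ∎


-- Feasible service patterns

single : ∀ j → Fin n → Tree n j
single zero    σ = leaf σ
single (suc j) σ = node (single j σ) []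

-- The interval just above the renewed levels archives its newest subinterval in `Js`. Level 0
-- counts as renewed even for `ρ` = 0, so every request becomes a new leaf.
update : Fin n → ℕ → Tree n j → Tree n j
update σ ρ (leaf _)            = leaf σ
update σ ρ (node {j = j} J Js) with suc j ≤? ρ | j ≤? ρ
... | yes _ | _     = single (suc j) σ
... | no _  | yes _ = node (update σ ρ J) (J ∷ Js)
... | no _  | no _  = node (update σ ρ J) Js

step-shrinks : ∀ {ρ} {J J′ : Tree n j} → Step ρ J J′ → ¬ j ℕ.≤ ρ → ∀ {D} → Good J′ D → Good J D
step-shrinks (renew j≤ρ)    j≰ρ g       = ⊥-elim (j≰ρ j≤ρ)
step-shrinks (keep _ _ sub) _   (b , f) = b , sub f

update-step : ∀ σ ρ (J : Tree n j) → Step ρ J (update σ ρ J)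
update-step σ ρ (leaf _)            = renew z≤n
update-step σ ρ (node {j = j} J Js) with suc j ≤? ρ | j ≤? ρ
... | yes j<ρ | _      = renew j<ρ
... | no j≮ρ  | yes _  = keep j≮ρ (update-step σ ρ J) All.tail
... | no j≮ρ  | no j≰ρ = keep j≮ρ (update-step σ ρ J) (λ { (g ∷ f) → step-shrinks (update-step σ ρ J) j≰ρ g ∷ f })

newest : Tree n j → Fin n
newest (leaf σ)   = σ
newest (node J _) = newest J

newest-single : ∀ j (σ : Fin n) → newest (single j σ) ≡ σ
newest-single zero    σ = refl
newest-single (suc j) σ = newest-single j σ

newest-update : ∀ σ ρ (J : Tree n j) → newest (update σ ρ J) ≡ σ
newest-update σ ρ (leaf _)            = refl
newest-update σ ρ (node {j = j} J Js) with suc j ≤? ρ | j ≤? ρ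
... | yes _ | _     = newest-single j σ
... | no _  | yes _ = newest-update σ ρ J
... | no _  | no _  = newest-update σ ρ J

-- The labels are pushed onto `C` in the order used by `Good` and `draw`, so that inductions on
-- trees line up.
Serves : Fin n → Vec (Fin n) j → List (Fin n) → Set
Serves σ []      C = σ ∈ C
Serves σ (b ∷ v) C = Serves σ v (b ∷ C)

serves-∈ : ∀ {σ : Fin n} {C} (v : Vec (Fin n) j) → σ ∈ C → Serves σ v C
serves-∈ []      m = m
serves-∈ (b ∷ v) m = serves-∈ v (there m)

serves⁻ : ∀ {σ : Fin n} {C} (v : Vec (Fin n) j) → Serves σ v C → (∃[ i ] Vec.lookup v i ≡ σ) ⊎ σ ∈ C
serves⁻ []      s = inj₂ s
serves⁻ (b ∷ v) s with serves⁻ v s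
... | inj₁ (i , e)       = inj₁ (suc i , e)
... | inj₂ (here refl)   = inj₁ (zero , refl)
... | inj₂ (there m)     = inj₂ m

draw-sound : ∀ (J : Tree n j) C → Good J C → All (λ pv → 0ℚ ≤ℚ proj₁ pv × Serves (newest J) (proj₂ pv) C) (draw J C)
draw-sound (leaf σ)    C g = (0≤1 , g) ∷ []
draw-sound (node J Js) C g = Allₚ.concat⁺ (Allₚ.map⁺ (All.map (λ { {b} (g′ ∷ _) →
  Allₚ.map⁺ (All.map (λ (0≤p , s) → *-nonNeg (0≤inv (length (labels (J ∷ Js) C))) 0≤p , s) (draw-sound J (b ∷ C) g′)) })
  (labels-feasible (J ∷ Js) C)))

redraw-sound : ∀ ρ (J : Tree n j) C v → Good J C →
               All (λ pv → 0ℚ ≤ℚ proj₁ pv × Serves (newest J) (proj₂ pv) C) (redraw ρ J C v)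
redraw-sound ρ (leaf σ)            C []      g = draw-sound (leaf σ) C g
redraw-sound ρ (node {j = j} J Js) C (a ∷ v) g with suc j ≤? ρ | fits? (J ∷ Js) (a ∷ C)
... | no _  | yes (g′ ∷ _) = Allₚ.map⁺ (redraw-sound ρ J (a ∷ C) v g′)
... | no _  | no _         = draw-sound (node J Js) C g
... | yes _ | _            = draw-sound (node J Js) C g

E-redraw-const : ∀ ρ (J : Tree n j) C v → Good J C → (c : ℚ) → E (redraw ρ J C v) (λ _ → c) ≡ c
E-redraw-const ρ (leaf σ)            C []      g c = E-draw-const (leaf σ) C g c
E-redraw-const ρ (node {j = j} J Js) C (a ∷ v) g c with suc j ≤? ρ | fits? (J ∷ Js) (a ∷ C)
... | no _  | yes (g′ ∷ _) = trans (E-map (a ∷_) (redraw ρ J (a ∷ C) v) (λ _ → c)) (E-redraw-const ρ J (a ∷ C) v g′ c)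
... | no _  | no _         = E-draw-const (node J Js) C g c
... | yes _ | _            = E-draw-const (node J Js) C g c

-- Newest intervals get explicit labels, which must be compared across rounds; for closed
-- subintervals the existence of labels is enough.
Witness : Tree n j → List (Fin n) → Vec (Fin n) j → Set
Witness (leaf σ)    C []      = σ ∈ C
Witness (node J Js) C (b ∷ v) = Witness J (b ∷ C) v × Fits Js (b ∷ C)

witness⇒good : ∀ (J : Tree n j) {C} v → Witness J C v → Good J C
witness⇒good (leaf σ)    []      m       = m
witness⇒good (node J Js) (b ∷ v) (s , f) = b , witness⇒good J v s ∷ f

witness-single : ∀ j {σ : Fin n} {C} (v : Vec (Fin n) j) → Serves σ v C → Witness (single j σ) C v
witness-single zero    []      s = s
witness-single (suc j) (b ∷ v) s = witness-single j v s , []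

AgreeAbove : ℕ → Vec (Fin n) j → Vec (Fin n) j → Set
AgreeAbove {j = zero}  ρ []      []        = ⊤
AgreeAbove {j = suc j} ρ (b ∷ v) (b′ ∷ v′) = (¬ suc j ℕ.≤ ρ → b ≡ b′) × AgreeAbove ρ v v′

-- Labels above `ρ` are unchanged and still fit the older subintervals. Where a subinterval is
-- archived, its former labels in `v` show that it is good.
witness-update : ∀ {σ ρ} (J : Tree n j) {C} v v′ → Witness J C v → AgreeAbove ρ v v′ → Serves σ v′ C →
                 Witness (update σ ρ J) C v′
witness-update         (leaf _)            []      []        _       _         s = s
witness-update {ρ = ρ} (node {j = j} J Js) (b ∷ v) (b′ ∷ v′) (u , f) (e , agr) s with suc j ≤? ρ | j ≤? ρ
... | yes _   | _     = witness-single (suc j) (b′ ∷ v′) s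
... | no j≮ρ  | d     with e j≮ρ
witness-update {ρ = ρ} (node {j = j} J Js) (b ∷ v) (_ ∷ v′) (u , f) (e , agr) s | no j≮ρ | yes _ | refl =
  witness-update J v v′ u agr s , witness⇒good J v u ∷ f
witness-update {ρ = ρ} (node {j = j} J Js) (b ∷ v) (_ ∷ v′) (u , f) (e , agr) s | no j≮ρ | no _  | refl =
  witness-update J v v′ u agr s , f

current : Input k n → List (Input k n) → Tree n k
current {k} (σ , ρ) []         = single k σ
current     (σ , ρ) (y ∷ past) = update σ (toℕ ρ) (current y past)

newest-current : ∀ (x : Input k n) past → newest (current x past) ≡ proj₁ x
newest-current {k} (σ , ρ) []         = newest-single k σ
newest-current     (σ , ρ) (y ∷ past) = newest-update σ (toℕ ρ) (current y past)

-- A labeling of intervals in time-indexed form: one vector of newest labels per round, where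
-- successive vectors may differ only at renewed levels.
Trace : Input k n → List (Input k n) → Vec (Fin n) k → Set
Trace (σ , ρ) []         v = Serves σ v []
Trace (σ , ρ) (y ∷ past) v = Serves σ v [] × ∃[ u ] (Trace y past u × AgreeAbove (toℕ ρ) u v)

trace⇒witness : ∀ (x : Input k n) past v → Trace x past v → Witness (current x past) [] v
trace⇒witness {k} (σ , ρ) []         v s                 = witness-single k v s
trace⇒witness     (σ , ρ) (y ∷ past) v (s , u , tr , ag) =
  witness-update (current y past) u v (trace⇒witness y past u tr) ag s

Traceable : List (Input k n) → Set
Traceable []         = ⊤
Traceable (x ∷ past) = ∃[ v ] Trace x past v

traceable-tail : ∀ (x : Input k n) past → Traceable (x ∷ past) → Traceable past
traceable-tail x []         _                    = tt
traceable-tail x (y ∷ past) (v , _ , u , tr , _) = u , tr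

-- Dropping the latest rounds of a trace leaves a trace; this supplies goodness at the intermediate
-- rounds of the cost induction.
traceable-prefix : ∀ (fut past : List (Input k n)) → Traceable (fut ʳ++ past) → Traceable past
traceable-prefix []        past t = t
traceable-prefix (x ∷ fut) past t = traceable-tail x past (traceable-prefix fut (x ∷ past) t)

traceable⇒good : ∀ (x : Input k n) past → Traceable (x ∷ past) → Good (current x past) []
traceable⇒good x past (v , tr) = witness⇒good (current x past) v (trace⇒witness x past v tr)

-- Vectors list the levels from the top down, configurations from the bottom up.
toVec : ∀ {A : Set} → (Fin j → A) → Vec A j
toVec {zero}  c = []
toVec {suc j} c = c (fromℕ j) ∷ toVec (c ∘ inject₁)

serves-toVec : ∀ {σ : Fin n} {C} (c : Fin j → Fin n) i → c i ≡ σ → Serves σ (toVec c) C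
serves-toVec {j = suc j} c i e with view i
... | ‵fromℕ     = serves-∈ (toVec (c ∘ inject₁)) (here (sym e))
... | ‵inject₁ i = serves-toVec (c ∘ inject₁) i e

agree-toVec : ∀ {ρ} (c c′ : Fin j → Fin n) → (∀ i → ¬ toℕ i ℕ.< ρ → c i ≡ c′ i) → AgreeAbove ρ (toVec c) (toVec c′)
agree-toVec {zero}  c c′ e = tt
agree-toVec {suc j} {ρ = ρ} c c′ e =
  (λ j≮ρ → e (fromℕ j) (j≮ρ ∘ subst (λ x → x ℕ.< ρ) (Finₚ.toℕ-fromℕ j))) ,
  agree-toVec (c ∘ inject₁) (c′ ∘ inject₁) (λ i i≮ρ → e (inject₁ i) (i≮ρ ∘ subst (λ x → x ℕ.< ρ) (Finₚ.toℕ-inject₁ i)))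

-- From labelings of interval patterns to traces

pattern-of : List (Input k n) → Pattern k
pattern-of {k} []               = emptyPattern k
pattern-of     ((σ , ρ) ∷ past) = extend (suc (length past)) (toℕ ρ) (pattern-of past)

revealFrom-pattern-of : ∀ (past xs : List (Input k n)) →
  revealFrom (suc (length past)) (pattern-of past) xs ≡ pattern-of (xs ʳ++ past)
revealFrom-pattern-of past []       = refl
revealFrom-pattern-of past (x ∷ xs) = revealFrom-pattern-of (x ∷ past) xs

-- The head is singled out by `toℕ i ≡ 0`, because the list is not syntactically nonempty.
EndsAt : ℕ → List Interval → Set
EndsAt t Is = ∀ i → proj₂ (lookup Is i) ℕ.≤ t × (toℕ i ≡ 0 → proj₂ (lookup Is i) ≡ t)

extend-endsAt : ∀ t ρ (P : Pattern k) i → EndsAt t (P i) → EndsAt (suc t) (extend t ρ P i)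
extend-endsAt t ρ P i inv l with toℕ i <? ρ | P i
... | yes _ | Is           with l
...   | zero  = ℕₚ.≤-refl , λ _ → refl
...   | suc l = ℕₚ.m≤n⇒m≤1+n (proj₁ (inv l)) , λ ()
extend-endsAt t ρ P i inv l | no _ | [] with l
...   | zero  = ℕₚ.≤-refl , λ _ → refl
extend-endsAt t ρ P i inv l | no _ | _ ∷ Is with l
...   | zero  = ℕₚ.≤-refl , λ _ → refl
...   | suc l = ℕₚ.m≤n⇒m≤1+n (proj₁ (inv (suc l))) , λ ()

pattern-of-endsAt : ∀ (past : List (Input k n)) i → EndsAt (suc (length past)) (pattern-of past i)
pattern-of-endsAt []               i ()
pattern-of-endsAt ((σ , ρ) ∷ past) i =
  extend-endsAt (suc (length past)) (toℕ ρ) (pattern-of past) i (pattern-of-endsAt past i)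

extend-first : ∀ t ρ (P : Pattern k) i → Σ[ z ∈ Fin (length (extend t ρ P i)) ] toℕ z ≡ 0
extend-first t ρ P i with toℕ i <? ρ | P i
... | yes _ | _     = zero , refl
... | no  _ | []    = zero , refl
... | no  _ | _ ∷ _ = zero , refl

-- Undoes one extension of a level. The three clauses provide what a trace needs: earlier requests
-- stay served, the current time lies only in the newest interval, and a continuing interval keeps
-- its label.
restrict : ∀ t ρ (P : Pattern k) i → EndsAt t (P i) → (lab : Fin (length (extend t ρ P i)) → Fin n) →
  Σ[ lab₀ ∈ (Fin (length (P i)) → Fin n) ]
    (∀ s → s ℕ.< t → ∀ l → s ∈ᵢ lookup (extend t ρ P i) l → ∃[ l₀ ] (s ∈ᵢ lookup (P i) l₀ × lab₀ l₀ ≡ lab l))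
  × (∀ l → t ∈ᵢ lookup (extend t ρ P i) l → toℕ l ≡ 0)
  × (¬ toℕ i ℕ.< ρ → ∀ l₀ l → toℕ l₀ ≡ 0 → toℕ l ≡ 0 → lab₀ l₀ ≡ lab l)
restrict t ρ P i inv lab with toℕ i <? ρ | P i
... | yes i<ρ | Is = lab ∘ suc ,
  (λ { s s<t zero (t≤s , _) → ⊥-elim (ℕₚ.<⇒≱ s<t t≤s) ; s s<t (suc l) m → l , m , refl }) ,
  (λ { zero _ → refl ; (suc l) (_ , t<e) → ⊥-elim (ℕₚ.<⇒≱ t<e (proj₁ (inv l))) }) ,
  (λ i≮ρ → ⊥-elim (i≮ρ i<ρ))
... | no _ | [] = (λ ()) ,
  (λ { s s<t zero (t≤s , _) → ⊥-elim (ℕₚ.<⇒≱ s<t t≤s) }) ,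
  (λ { zero _ → refl }) ,
  (λ _ ())
... | no _ | (a , e) ∷ Is = lab ,
  -- The old head ended exactly at `t`, so `s < t` puts `s` inside it.
  (λ { s s<t zero (a≤s , _) → zero , (a≤s , subst (s ℕ.<_) (sym (proj₂ (inv zero) refl)) s<t) , refl
     ; s s<t (suc l) m → suc l , m , refl }) ,
  (λ { zero _ → refl ; (suc l) (_ , t<e) → ⊥-elim (ℕₚ.<⇒≱ t<e (proj₁ (inv (suc l)))) }) ,
  (λ { _ zero zero _ _ → refl })

data RequestAt {k n : ℕ} : List (Input k n) → ℕ → Fin n → Set where
  now    : ∀ {σ ρ past} → RequestAt ((σ , ρ) ∷ past) (suc (length past)) σ
  before : ∀ {x past t σ} → RequestAt past t σ → RequestAt (x ∷ past) t σ

requestAt-≤ : ∀ {past : List (Input k n)} {t σ} → RequestAt past t σ → t ℕ.≤ length past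
requestAt-≤ now        = ℕₚ.≤-refl
requestAt-≤ (before r) = ℕₚ.m≤n⇒m≤1+n (requestAt-≤ r)

Served : (past : List (Input k n)) → Labeling k n (pattern-of past) → Set
Served past lab = ∀ {t σ} → RequestAt past t σ → ∃[ i ] ∃[ l ] (t ∈ᵢ lookup (pattern-of past i) l × lab i l ≡ σ)

first : ∀ (x : Input k n) past i → Σ[ z ∈ Fin (length (pattern-of (x ∷ past) i)) ] toℕ z ≡ 0
first (σ , ρ) past i = extend-first (suc (length past)) (toℕ ρ) (pattern-of past) i

-- The newest labels of the present form the last vector of the trace; `restrict` yields a labeling
-- of the previous pattern, on which the argument repeats.
served⇒trace : ∀ (x : Input k n) past (lab : Labeling k n (pattern-of (x ∷ past))) → Served (x ∷ past) lab →
               Trace x past (toVec (λ i → lab i (proj₁ (first x past i))))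
served⇒trace {k} {n} x@(σ , ρ) past lab srv = go past lab srv
  where
  module Restriction (past : List (Input k n)) (lab : Labeling k n (pattern-of (x ∷ past))) (srv : Served (x ∷ past) lab) where
    R : ∀ i → _
    R i = restrict (suc (length past)) (toℕ ρ) (pattern-of past) i (pattern-of-endsAt past i) (lab i)
    serves : Serves σ (toVec (λ i → lab i (proj₁ (first x past i)))) []
    serves with srv now
    -- The interval serving the current request must be the head of its level, so its label is in
    -- the vector.
    ... | i , l , m , e = serves-toVec (λ i → lab i (proj₁ (first x past i))) i
      (trans (cong (lab i) (Finₚ.toℕ-injective (trans (proj₂ (first x past i)) (sym (proj₁ (proj₂ (proj₂ (R i))) l m))))) e)
  go : ∀ past (lab : Labeling k n (pattern-of (x ∷ past))) → Served (x ∷ past) lab →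
       Trace x past (toVec (λ i → lab i (proj₁ (first x past i))))
  go []         lab srv = Restriction.serves [] lab srv
  go (y ∷ past) lab srv = serves , toVec (λ i → lab₀ i (proj₁ (first y past i))) , served⇒trace y past lab₀ srv₀ ,
    agree-toVec _ _ (λ i i≮ρ → proj₂ (proj₂ (proj₂ (R i))) i≮ρ _ _ (proj₂ (first y past i)) (proj₂ (first x (y ∷ past) i)))
    where
    open Restriction (y ∷ past) lab srv
    lab₀ : Labeling k n (pattern-of (y ∷ past))
    lab₀ i = proj₁ (R i)
    srv₀ : Served (y ∷ past) lab₀
    srv₀ {t} r with srv (before r)
    ... | i , l , m , e with proj₁ (proj₂ (R i)) t (s≤s (requestAt-≤ r)) l m
    ...   | l₀ , m₀ , e₀ = i , l₀ , m₀ , trans e₀ e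

Position : ∀ {A : Set} → List A → ℕ → A → Set
Position as t a = Σ[ f ∈ Fin (length as) ] (suc (toℕ f) ≡ t × lookup as f ≡ a)

position-++ : ∀ {A : Set} (as bs : List A) {t a} → Position as t a → Position (as ++ bs) t a
position-++ (_ ∷ as) bs (zero  , refl , e) = zero , refl , e
position-++ (_ ∷ as) bs (suc f , refl , e) with position-++ as bs (f , refl , e)
... | g , p , q = suc g , cong suc p , q

position-last : ∀ {A : Set} (as : List A) a → Position (as ++ a ∷ []) (suc (length as)) a
position-last []       a = zero , refl , refl
position-last (_ ∷ as) a with position-last as a
... | g , p , q = suc g , cong suc p , q

requestAt⇒position : ∀ {past : List (Input k n)} {t σ} → RequestAt past t σ → Position (map proj₁ (reverse past)) t σ
requestAt⇒position {past = x@(σ , ρ) ∷ past} now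
  rewrite Listₚ.unfold-reverse x past | Listₚ.map-++ proj₁ (reverse past) (x ∷ []) =
  subst (λ m → Position (map proj₁ (reverse past) ++ σ ∷ []) (suc m) σ)
    (trans (Listₚ.length-map proj₁ (reverse past)) (Listₚ.length-reverse past)) (position-last (map proj₁ (reverse past)) σ)
requestAt⇒position {past = x ∷ past} (before r)
  rewrite Listₚ.unfold-reverse x past | Listₚ.map-++ proj₁ (reverse past) (x ∷ []) =
  position-++ (map proj₁ (reverse past)) (proj₁ x ∷ []) (requestAt⇒position r)

feasible⇒traceable : ∀ (past : List (Input k n)) → Feasible n (pattern-of past) (map proj₁ (reverse past)) → Traceable past
feasible⇒traceable []         _            = tt
feasible⇒traceable (x ∷ past) (lab , feas) = _ , served⇒trace x past lab served
  where
  served : Served (x ∷ past) lab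
  served r with requestAt⇒position r
  ... | f , refl , refl = feas f

valid⇒traceable : ∀ (xs : List (Input k n)) → ValidInput xs → Traceable (reverse xs)
valid⇒traceable []               _           = tt
-- Feasibility is taken at the last round, where `take` returns the whole input.
valid⇒traceable {n = n} xs@(_ ∷ _) (_ , feas) = feasible⇒traceable (reverse xs)
  (subst (Feasible n (pattern-of (reverse xs))) (cong (map proj₁) (sym (Listₚ.reverse-involutive xs)))
    (subst (λ P → Feasible n P (map proj₁ xs)) (revealFrom-pattern-of [] xs)
      (subst (λ ys → Feasible n (revealed ys) (map proj₁ ys)) (Listₚ.take-all (length xs) xs ℕₚ.≤-refl)
        (feas (length xs) (s≤s z≤n) ℕₚ.≤-refl))))


-- The online algorithm

sumFin-cong : ∀ k {f g : Fin k → ℚ} → (∀ i → f i ≡ g i) → sumFin k f ≡ sumFin k g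
sumFin-cong zero    e = refl
sumFin-cong (suc k) e = cong₂ _+_ (e zero) (sumFin-cong k (λ i → e (suc i)))

sumFin-+ : ∀ k (f g : Fin k → ℚ) → sumFin k (λ i → f i + g i) ≡ sumFin k f + sumFin k g
sumFin-+ zero    f g = refl
sumFin-+ (suc k) f g = trans (cong ((f zero + g zero) +_) (sumFin-+ k (f ∘ suc) (g ∘ suc)))
  (solve 4 (λ x y s t → (x :+ y) :+ (s :+ t) := (x :+ s) :+ (y :+ t)) refl (f zero) (g zero) (sumFin k (f ∘ suc)) (sumFin k (g ∘ suc)))

sumFin-last : ∀ k (f : Fin (suc k) → ℚ) → sumFin (suc k) f ≡ f (fromℕ k) + sumFin k (f ∘ inject₁)
sumFin-last zero    f = refl
sumFin-last (suc k) f = trans (cong (f zero +_) (sumFin-last k (f ∘ suc)))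
  (solve 3 (λ x y s → x :+ (y :+ s) := y :+ (x :+ s)) refl (f zero) (f (fromℕ (suc k))) (sumFin k (f ∘ suc ∘ inject₁)))

sumFin-full : ∀ k (w : Fin k → ℚ) → sumFin k w ≡ full (toVec w)
sumFin-full zero    w = refl
sumFin-full (suc k) w = trans (sumFin-last k w) (cong (w (fromℕ k) +_) (sumFin-full k (w ∘ inject₁)))

moveCost-moved : ∀ k (w : Fin k → ℚ) (c c′ : Config k n) → moveCost w c c′ ≡ moved (toVec w) (toVec c) (toVec c′)
moveCost-moved zero    w c c′ = refl
moveCost-moved (suc k) w c c′ = trans (sumFin-last k (λ i → if ⌊ c i Finₚ.≟ c′ i ⌋ then 0ℚ else w i))
  (cong ((if ⌊ c (fromℕ k) Finₚ.≟ c′ (fromℕ k) ⌋ then 0ℚ else w (fromℕ k)) +_)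
    (moveCost-moved k (w ∘ inject₁) (c ∘ inject₁) (c′ ∘ inject₁)))

-- The growth of the pattern cost in any round after the first, with the levels listed from the top
-- down.
increment : ℕ → Vec ℚ j → ℚ
increment ρ []             = 0ℚ
increment ρ (_∷_ {n = j} w ws) = (if ⌊ j <? ρ ⌋ then w else 0ℚ) + increment ρ ws

sumFin-increment : ∀ k ρ (w : Fin k → ℚ) →
  sumFin k (λ i → if ⌊ toℕ i <? ρ ⌋ then w i else 0ℚ) ≡ increment ρ (toVec w)
sumFin-increment zero    ρ w = refl
sumFin-increment (suc k) ρ w = trans (sumFin-last k (λ i → if ⌊ toℕ i <? ρ ⌋ then w i else 0ℚ)) (cong₂ _+_
  (cong (λ t → if ⌊ t <? ρ ⌋ then w (fromℕ k) else 0ℚ) (Finₚ.toℕ-fromℕ k))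
  (trans (sumFin-cong k (λ i → cong (λ t → if ⌊ t <? ρ ⌋ then w (inject₁ i) else 0ℚ) (Finₚ.toℕ-inject₁ i)))
    (sumFin-increment k ρ (w ∘ inject₁))))

increment-nonNeg : ∀ ρ {ws : Vec ℚ j} → NonNegs ws → 0ℚ ≤ℚ increment ρ ws
increment-nonNeg ρ [] = ≤-refl
increment-nonNeg {suc j} ρ (p ∷ ps) with j <? ρ
... | yes _ = +-nonNeg p (increment-nonNeg ρ ps)
... | no  _ = +-nonNeg ≤-refl (increment-nonNeg ρ ps)

increment-renew : ∀ {ρ} (ws : Vec ℚ j) → j ℕ.≤ ρ → increment ρ ws ≡ full ws
increment-renew         []             _   = refl
increment-renew {ρ = ρ} (_∷_ {n = j} w ws) j<ρ with j <? ρ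
... | yes _   = cong (w +_) (increment-renew ws (ℕₚ.<⇒≤ j<ρ))
... | no  j≮ρ = ⊥-elim (j≮ρ j<ρ)

toVec-cong : ∀ {A : Set} {c c′ : Fin j → A} → (∀ i → c i ≡ c′ i) → toVec c ≡ toVec c′
toVec-cong {zero}  e = refl
toVec-cong {suc j} e = cong₂ _∷_ (e (fromℕ j)) (toVec-cong (λ i → e (inject₁ i)))

toConfig : Vec (Fin n) k → Config k n
toConfig v i = Vec.lookup v (opposite i)

opposite-fromℕ : ∀ j → opposite (fromℕ j) ≡ zero
opposite-fromℕ zero    = refl
opposite-fromℕ (suc j) = cong inject₁ (opposite-fromℕ j)

opposite-inject₁ : ∀ (i : Fin j) → opposite (inject₁ i) ≡ suc (opposite i)
opposite-inject₁ zero    = refl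
opposite-inject₁ (suc i) = cong inject₁ (opposite-inject₁ i)

toVec-toConfig : ∀ (v : Vec (Fin n) j) → toVec (toConfig v) ≡ v
toVec-toConfig             []      = refl
toVec-toConfig {j = suc j} (a ∷ v) = cong₂ _∷_ (cong (Vec.lookup (a ∷ v)) (opposite-fromℕ j))
  (trans (toVec-cong (λ i → cong (Vec.lookup (a ∷ v)) (opposite-inject₁ i))) (toVec-toConfig v))

serves⇒covers : ∀ {σ : Fin n} (v : Vec (Fin n) k) → Serves σ v [] → Covers (toConfig v) σ
serves⇒covers v s with serves⁻ v s
... | inj₁ (i , e) = opposite i , trans (cong (Vec.lookup v) (Finₚ.opposite-involutive i)) e

sample : Input k n → List (Input k n) → Vec (Fin n) k → List (ℚ × Vec (Fin n) k)
-- The initial configuration is arbitrary, so the first round keeps no label.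
sample x []         v = draw (current x []) []
sample x (y ∷ past) v = redraw (toℕ (proj₂ x)) (current x (y ∷ past)) [] v

sample-sound : ∀ (x : Input k n) past v → Good (current x past) [] →
               All (λ pv → 0ℚ ≤ℚ proj₁ pv × Serves (proj₁ x) (proj₂ pv) []) (sample x past v)
sample-sound x past v g = subst (λ σ → All (λ pv → 0ℚ ≤ℚ proj₁ pv × Serves σ (proj₂ pv) []) (sample x past v))
  (newest-current x past) (newest-sound past v g)
  where
  newest-sound : ∀ past v → Good (current x past) [] →
          All (λ pv → 0ℚ ≤ℚ proj₁ pv × Serves (newest (current x past)) (proj₂ pv) []) (sample x past v)
  newest-sound []         v g = draw-sound (current x []) [] g
  newest-sound (y ∷ past) v g = redraw-sound (toℕ (proj₂ x)) (current x (y ∷ past)) [] v g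

E-sample-const : ∀ (x : Input k n) past v → Good (current x past) [] → (c : ℚ) → E (sample x past v) (λ _ → c) ≡ c
E-sample-const x []         v g c = E-draw-const (current x []) [] g c
E-sample-const x (y ∷ past) v g c = E-redraw-const (toℕ (proj₂ x)) (current x (y ∷ past)) [] v g c

-- On infeasible inputs, where nothing has to be proved about the cost, all servers go to the request.
algorithm : Alg k n
algorithm x past c cs with good? (current x past) []
... | yes _ = map (λ pv → proj₁ pv , toConfig (proj₂ pv)) (sample x past (toVec c))
... | no  _ = (1ℚ , λ _ → proj₁ x) ∷ []

algorithm-valid : ValidAlg {suc k} {n} algorithm
algorithm-valid x past c cs with good? (current x past) []
... | yes g = Allₚ.map⁺ (All.map (λ {pv} (0≤p , s) → 0≤p , serves⇒covers (proj₂ pv) s) (sample-sound x past (toVec c) g)) ,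
  (begin
    sumList (map proj₁ (map (λ pv → proj₁ pv , toConfig (proj₂ pv)) (sample x past (toVec c))))
                                              ≡⟨ cong sumList (sym (Listₚ.map-∘ (sample x past (toVec c)))) ⟩
    ∑ (sample x past (toVec c)) proj₁         ≡⟨ ∑-cong (sample x past (toVec c)) (λ pv → sym (*-identityʳ (proj₁ pv))) ⟩
    E (sample x past (toVec c)) (λ _ → 1ℚ)    ≡⟨ E-sample-const x past (toVec c) g 1ℚ ⟩
    1ℚ ∎)
  where
  open ≡-Reasoning
... | no _ = (0≤1 , zero , refl) ∷ [] , +-identityʳ 1ℚ

-- The algorithm reads only the inputs and its current configuration; resetting the earlier
-- configurations turns the cost into a function of the current labels.
expCost-history : ∀ (w : Fin k → ℚ) past (c : Config k n) cs cs′ fut →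
  expCostFrom w algorithm past c cs fut ≡ expCostFrom w algorithm past c cs′ fut
expCost-history w past c cs cs′ []        = refl
expCost-history w past c cs cs′ (x ∷ fut) = E-cong (algorithm x past c cs) (λ c′ →
  cong (moveCost w c c′ +_) (expCost-history w (x ∷ past) c′ (c ∷ cs) (c ∷ cs′) fut))

E-algorithm : ∀ (x : Input k n) past c cs (f : Config k n → ℚ) → Good (current x past) [] →
              E (algorithm x past c cs) f ≡ E (sample x past (toVec c)) (λ v → f (toConfig v))
E-algorithm x past c cs f g with good? (current x past) []
... | yes _ = E-map toConfig (sample x past (toVec c)) f
... | no ¬g = ⊥-elim (¬g g)

expCost-step : ∀ (w : Fin k → ℚ) (x : Input k n) past c cs fut → Good (current x past) [] →
  expCostFrom w algorithm past c cs (x ∷ fut)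
  ≡ E (sample x past (toVec c)) (λ v → moved (toVec w) (toVec c) v + expCostFrom w algorithm (x ∷ past) (toConfig v) [] fut)
expCost-step {k} w x past c cs fut g = trans (E-algorithm x past c cs _ g) (E-cong (sample x past (toVec c)) (λ v →
  cong₂ _+_ (trans (moveCost-moved k w c (toConfig v)) (cong (moved (toVec w) (toVec c)) (toVec-toConfig v)))
    (expCost-history w (x ∷ past) (toConfig v) (c ∷ cs) [] fut)))

-- Growth of the revealed pattern's cost

increments : Vec ℚ k → List (Input k n) → ℚ
increments ws xs = ∑ xs (λ x → increment (toℕ (proj₂ x)) ws)

-- The element of `Fin (length (P i))` certifies a nonempty level; an empty one would gain an
-- interval whatever `ρ` is.
extend-length : ∀ (w : Fin k → ℚ) t ρ (P : Pattern k) i → Fin (length (P i)) →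
  w i * ι (length (extend t ρ P i)) ≡ w i * ι (length (P i)) + (if ⌊ toℕ i <? ρ ⌋ then w i else 0ℚ)
extend-length w t ρ P i l with toℕ i <? ρ | P i
... | yes _ | Is     = trans (cong (w i *_) (ι-suc (length Is)))
  (solve 2 (λ w l → w :* (con 1ℚ :+ l) := w :* l :+ w) refl (w i) (ι (length Is)))
... | no _  | I ∷ Is = sym (+-identityʳ (w i * ι (length (I ∷ Is))))

patternCost-step : ∀ (w : Fin k → ℚ) (x y : Input k n) past →
  patternCost w (pattern-of (x ∷ y ∷ past)) ≡ patternCost w (pattern-of (y ∷ past)) + increment (toℕ (proj₂ x)) (toVec w)
patternCost-step {k} w x y past = trans
  (sumFin-cong k (λ i → extend-length w (suc (suc (length past))) (toℕ (proj₂ x)) (pattern-of (y ∷ past)) i (proj₁ (first y past i))))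
  (trans (sumFin-+ k (λ i → w i * ι (length (pattern-of (y ∷ past) i))) _)
    (cong (patternCost w (pattern-of (y ∷ past)) +_) (sumFin-increment k (toℕ (proj₂ x)) w)))

patternCost-first : ∀ (w : Fin k → ℚ) (x : Input k n) → patternCost w (pattern-of (x ∷ [])) ≡ full (toVec w)
patternCost-first {k} w x = trans (sumFin-cong k one) (sumFin-full k w)
  where
  one : ∀ i → w i * ι (length (pattern-of (x ∷ []) i)) ≡ w i
  one i with toℕ i <? toℕ (proj₂ x)
  ... | yes _ = *-identityʳ (w i)
  ... | no  _ = *-identityʳ (w i)

patternCost-increments : ∀ (w : Fin k → ℚ) fut (y : Input k n) past →
  patternCost w (pattern-of (fut ʳ++ (y ∷ past))) ≡ patternCost w (pattern-of (y ∷ past)) + increments (toVec w) fut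
patternCost-increments w []        y past = sym (+-identityʳ (patternCost w (pattern-of (y ∷ past))))
patternCost-increments w (x ∷ fut) y past = trans (patternCost-increments w fut x (y ∷ past))
  (trans (cong (_+ increments (toVec w) fut) (patternCost-step w x y past))
    (+-assoc (patternCost w (pattern-of (y ∷ past))) (increment (toℕ (proj₂ x)) (toVec w)) (increments (toVec w) fut)))

-- The competitive ratio

module Competitive (Y : ℕ) (q : ℚ) (φ-q : 1ℚ + (1ℚ + harmonic Y) ≤ℚ q) where
  open Potential Y q φ-q

  1≤q : 1ℚ ≤ℚ q
  1≤q = ≤-trans (≤-+ʳ (+-nonNeg 0≤1 (harmonic-nonNeg Y))) φ-q

  ≤-q* : ∀ {p} → 0ℚ ≤ℚ p → p ≤ℚ q * p
  ≤-q* {p} 0≤p = ≤-trans (≤-reflexive (sym (*-identityˡ p))) (*-monoˡ 0≤p 1≤q)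

  1≤pow : ∀ j → 1ℚ ≤ℚ pow q j
  1≤pow zero    = ≤-refl
  1≤pow (suc j) = ≤-trans (1≤pow j) (≤-q* (pow-nonNeg 0≤q j))

  -- Unfolding `restart` multiplies the i-th weight from the top by q^i, which is at most q^j as `q`
  -- is at least 1.
  restart≤ : ∀ {ws : Vec ℚ j} → NonNegs ws → restart ws ≤ℚ pow q j * full ws
  restart≤ [] = ≤-refl
  restart≤ {suc j} {w ∷ ws} (p ∷ ps) = begin
    (w + restart ws) * q                ≤⟨ *-monoˡ 0≤q (+-mono-≤ (≤-trans (≤-reflexive (sym (*-identityˡ w))) (*-monoˡ p (1≤pow j))) (restart≤ ps)) ⟩
    (pow q j * w + pow q j * full ws) * q ≡⟨ solve 4 (λ a w f q → (a :* w :+ a :* f) :* q := q :* a :* (w :+ f)) refl (pow q j) w (full ws) q ⟩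
    q * pow q j * (w + full ws) ∎
    where open ≤-Reasoning

  -- The highest renewed level renews all levels below it, and their total weight is what the
  -- adversary pays in `increment`.
  charge≤ : ∀ ρ {ws : Vec ℚ j} → NonNegs ws → charge ρ ws ≤ℚ pow q j * increment ρ ws
  charge≤ ρ [] = ≤-refl
  charge≤ {suc j} ρ {w ∷ ws} (p ∷ ps) = cases (suc j ≤? ρ)
    where
    open ≤-Reasoning
    cases : Dec (suc j ℕ.≤ ρ) → charge ρ (w ∷ ws) ≤ℚ pow q (suc j) * increment ρ (w ∷ ws)
    cases (yes j<ρ) = begin
      charge ρ (w ∷ ws)                        ≡⟨ charge-renew (w ∷ ws) j<ρ ⟩
      restart (w ∷ ws)                         ≤⟨ restart≤ (p ∷ ps) ⟩
      pow q (suc j) * full (w ∷ ws)            ≡⟨ cong (pow q (suc j) *_) (sym (increment-renew (w ∷ ws) j<ρ)) ⟩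
      pow q (suc j) * increment ρ (w ∷ ws) ∎
    cases (no j≮ρ) = begin
      charge ρ (w ∷ ws)                        ≡⟨ charge-keep w ws j≮ρ ⟩
      charge ρ ws                              ≤⟨ charge≤ ρ ps ⟩
      pow q j * increment ρ ws                 ≤⟨ ≤-q* (*-nonNeg (pow-nonNeg 0≤q j) (increment-nonNeg ρ ps)) ⟩
      q * (pow q j * increment ρ ws)           ≡⟨ sym (*-assoc q (pow q j) (increment ρ ws)) ⟩
      pow q (suc j) * increment ρ ws           ≤⟨ *-monoʳ (pow-nonNeg 0≤q (suc j)) (≤-+ˡ (if-nonNeg (j <? ρ))) ⟩
      pow q (suc j) * increment ρ (w ∷ ws) ∎
      where
      if-nonNeg : (d : Dec (j ℕ.< ρ)) → 0ℚ ≤ℚ (if ⌊ d ⌋ then w else 0ℚ)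
      if-nonNeg (yes _) = p
      if-nonNeg (no  _) = ≤-refl

  module _ (w : Fin k → ℚ) (ps : NonNegs (toVec w)) (bY : bound k ℕ.≤ Y) where

    private
      ws : Vec ℚ k
      ws = toVec w
      K : ℚ
      K = pow q k

    cost : List (Input k n) → List (Input k n) → Vec (Fin n) k → ℚ
    cost past fut v = expCostFrom w algorithm past (toConfig v) [] fut

    -- Induction on the remaining input, with the labels distributed as `draw` for the current tree:
    -- `potential-step` pays for the moves and `redraw-stationary` restores the distribution.
    cost-bound : ∀ fut (y : Input k n) past → Traceable (fut ʳ++ (y ∷ past)) →
      E (draw (current y past) []) (cost (y ∷ past) fut) ≤ℚ potential ws (current y past) [] + K * increments ws fut
    cost-bound []        y past tr = begin
      E (draw J []) (λ _ → 0ℚ)                    ≡⟨ E-draw-const J [] (traceable⇒good y past tr) 0ℚ ⟩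
      0ℚ                                          ≤⟨ potential-nonNeg ps J [] ⟩
      potential ws J []                           ≤⟨ ≤-+ʳ (≤-reflexive (sym (*-zeroʳ K))) ⟩
      potential ws J [] + K * 0ℚ ∎
      where
      open ≤-Reasoning
      J = current y past
    cost-bound (x@(σ , ρ) ∷ fut) y past tr = begin
      E (draw J []) (cost (y ∷ past) (x ∷ fut))
        ≡⟨ E-cong (draw J []) (λ v → trans (expCost-step w x (y ∷ past) (toConfig v) [] fut g′)
             (trans (cong (λ u → E (redraw r J′ [] u) (λ v′ → moved ws u v′ + V v′)) (toVec-toConfig v))
               (E-+ (redraw r J′ [] v) (moved ws v) V))) ⟩
      E (draw J []) (λ v → E (redraw r J′ [] v) (moved ws v) + E (redraw r J′ [] v) V)
        ≡⟨ E-+ (draw J []) (λ v → E (redraw r J′ [] v) (moved ws v)) (λ v → E (redraw r J′ [] v) V) ⟩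
      M + E (draw J []) (λ v → E (redraw r J′ [] v) V)
        ≡⟨ cong (M +_) (redraw-stationary st [] g g′ V) ⟩
      M + E (draw J′ []) V
        ≤⟨ +-monoʳ-≤ M (cost-bound fut x (y ∷ past) tr) ⟩
      M + (potential ws J′ [] + K * increments ws fut)
        ≡⟨ sym (+-assoc M (potential ws J′ []) (K * increments ws fut)) ⟩
      (M + potential ws J′ []) + K * increments ws fut
        ≤⟨ +-monoˡ-≤ (K * increments ws fut) (potential-step ps bY st [] g g′) ⟩
      (potential ws J [] + charge r ws) + K * increments ws fut
        ≤⟨ +-monoˡ-≤ (K * increments ws fut) (+-monoʳ-≤ (potential ws J []) (charge≤ r ps)) ⟩
      (potential ws J [] + K * increment r ws) + K * increments ws fut
        ≡⟨ solve 4 (λ p k a b → (p :+ k :* a) :+ k :* b := p :+ k :* (a :+ b)) refl (potential ws J []) K (increment r ws) (increments ws fut) ⟩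
      potential ws J [] + K * increments ws (x ∷ fut) ∎
      where
      open ≤-Reasoning
      r  = toℕ ρ
      J  = current y past
      J′ = current x (y ∷ past)
      st : Step r J J′
      st = update-step σ r J
      V  = cost (x ∷ y ∷ past) fut
      M  = E (draw J []) (λ v → E (redraw r J′ [] v) (moved ws v))
      tr′ = traceable-prefix fut (x ∷ y ∷ past) tr
      g′ : Good J′ []
      g′ = traceable⇒good x (y ∷ past) tr′
      g : Good J []
      g = traceable⇒good y past (traceable-tail x (y ∷ past) tr′)

    -- The first round may move every server and must build up the potential; `restart` covers both,
    -- and the first pattern costs exactly `full ws`.
    expCost-bound : ∀ (c₀ : Config k n) x fut → Traceable (fut ʳ++ (x ∷ [])) →
      expCost w algorithm c₀ (x ∷ fut) ≤ℚ K * patternCost w (pattern-of (fut ʳ++ (x ∷ [])))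
    expCost-bound c₀ x fut tr = begin
      expCost w algorithm c₀ (x ∷ fut)
        ≡⟨ expCost-step w x [] c₀ [] fut g ⟩
      E (draw J []) (λ v → moved ws (toVec c₀) v + cost (x ∷ []) fut v)
        ≡⟨ E-+ (draw J []) (moved ws (toVec c₀)) (cost (x ∷ []) fut) ⟩
      E (draw J []) (moved ws (toVec c₀)) + E (draw J []) (cost (x ∷ []) fut)
        ≤⟨ +-mono-≤ (E-moved≤full ps J [] g (toVec c₀)) (cost-bound fut x [] tr) ⟩
      full ws + (potential ws J [] + K * Δ)
        ≡⟨ sym (+-assoc (full ws) (potential ws J []) (K * Δ)) ⟩
      (full ws + potential ws J []) + K * Δ
        ≤⟨ +-monoˡ-≤ (K * Δ) (≤-trans (full+potential≤restart ps J [] g) (restart≤ ps)) ⟩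
      K * full ws + K * Δ
        ≡⟨ sym (*-distribˡ-+ K (full ws) Δ) ⟩
      K * (full ws + Δ)
        ≡⟨ cong (λ p → K * (p + Δ)) (sym (patternCost-first w x)) ⟩
      K * (patternCost w (pattern-of (x ∷ [])) + Δ)
        ≡⟨ cong (K *_) (sym (patternCost-increments w fut x [])) ⟩
      K * patternCost w (pattern-of (fut ʳ++ (x ∷ []))) ∎
      where
      open ≤-Reasoning
      J = current x []
      Δ = increments ws fut
      g : Good J []
      g = traceable⇒good x [] (traceable-prefix fut (x ∷ []) tr)

toVec-nonNegs : ∀ (w : Fin j → ℚ) → (∀ i → 0ℚ ≤ℚ w i) → NonNegs (toVec w)
toVec-nonNegs {zero}  w p = []
toVec-nonNegs {suc j} w p = p (fromℕ j) ∷ toVec-nonNegs (w ∘ inject₁) (λ i → p (inject₁ i))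

sumFin-nonNeg : ∀ k {f : Fin k → ℚ} → (∀ i → 0ℚ ≤ℚ f i) → 0ℚ ≤ℚ sumFin k f
sumFin-nonNeg zero    p = ≤-refl
sumFin-nonNeg (suc k) p = +-nonNeg (p zero) (sumFin-nonNeg k (λ i → p (suc i)))

pow-ι : ∀ a m → pow (ι a) m ≡ ι (a ℕ.^ m)
pow-ι a zero    = refl
pow-ι a (suc m) = trans (cong (ι a *_) (pow-ι a m)) (sym (ι-* a (a ℕ.^ m)))

-- For `suc k` levels, H(Y) is at most 2^(k+1), and the two additional units are absorbed by
-- doubling.
moves-per-level : ∀ k → 1ℚ + (1ℚ + harmonic (bound (suc k))) ≤ℚ ι (2 ℕ.^ suc (suc k))
moves-per-level k = begin
  1ℚ + (1ℚ + harmonic (bound (suc k))) ≤⟨ +-monoʳ-≤ 1ℚ (+-monoʳ-≤ 1ℚ (harmonic-2^ (logBound (suc k)))) ⟩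
  1ℚ + (1ℚ + ι (suc (logBound (suc k)))) ≡⟨ cong (λ m → 1ℚ + (1ℚ + ι m)) (suc-logBound (suc k)) ⟩
  1ℚ + (1ℚ + ι (2 ℕ.^ suc k))          ≡⟨ trans (cong (1ℚ +_) (sym (ι-suc (2 ℕ.^ suc k)))) (sym (ι-suc (suc (2 ℕ.^ suc k)))) ⟩
  ι (2 ℕ.+ 2 ℕ.^ suc k)                ≤⟨ ι-mono (ℕₚ.+-mono-≤ (ℕₚ.^-monoʳ-≤ 2 (s≤s (z≤n {k}))) (ℕₚ.m≤m+n (2 ℕ.^ suc k) 0)) ⟩
  ι (2 ℕ.^ suc (suc k)) ∎
  where open ≤-Reasoning

-- The exponents satisfy (k+2)(k+1) ≤ 2(k+1)².
total-factor : ∀ k → pow (ι (2 ℕ.^ suc (suc k))) (suc k) ≤ℚ ι (2 ℕ.^ (2 ℕ.* suc k ℕ.* suc k))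
total-factor k = begin
  pow (ι (2 ℕ.^ suc (suc k))) (suc k)   ≡⟨ pow-ι (2 ℕ.^ suc (suc k)) (suc k) ⟩
  ι ((2 ℕ.^ suc (suc k)) ℕ.^ suc k)     ≡⟨ cong ι (ℕₚ.^-*-assoc 2 (suc (suc k)) (suc k)) ⟩
  ι (2 ℕ.^ (suc (suc k) ℕ.* suc k))     ≤⟨ ι-mono (ℕₚ.^-monoʳ-≤ 2 (ℕₚ.*-monoˡ-≤ (suc k) exponent)) ⟩
  ι (2 ℕ.^ (2 ℕ.* suc k ℕ.* suc k)) ∎
  where
  open ≤-Reasoning
  exponent : suc (suc k) ℕ.≤ 2 ℕ.* suc k
  exponent = s≤s (ℕₚ.≤-trans (s≤s (ℕₚ.m≤m+n k 0)) (ℕₚ.m≤n+m (suc (k ℕ.+ 0)) k))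

open import Data.Integer using (+_)

theorem2 : ∃[ C ] ((k : ℕ) → 1 ≤ k → (w : Fin k → ℚ) → ((i : Fin k) → 0ℚ <ℚ w i) → ((i j : Fin k) → i Data.Fin.≤ j → w i ≤ℚ w j) → (n : ℕ) → Σ (Alg k n) (λ A → ValidAlg A × ((c₀ : Config k n) (xs : List (Input k n)) → ValidInput xs → expCost w A c₀ xs ≤ℚ ((+ (2 ^ (C Data.Nat.* k Data.Nat.* k))) / 1) * patternCost w (revealed xs))))
-- The constant 2 is the one from `total-factor`.
theorem2 = 2 , λ { (suc k) _ w 0<w _ n → algorithm , algorithm-valid , λ c₀ xs valid → competitive w (λ i → <⇒≤ (0<w i)) c₀ xs valid }
  where
  patternCost-nonNeg : ∀ (w : Fin k → ℚ) → (∀ i → 0ℚ ≤ℚ w i) → (P : Pattern k) → 0ℚ ≤ℚ patternCost w P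
  patternCost-nonNeg {k} w 0≤w P = sumFin-nonNeg k (λ i → *-nonNeg (0≤w i) (0≤ι (length (P i))))
  competitive : ∀ (w : Fin (suc k) → ℚ) → (∀ i → 0ℚ ≤ℚ w i) → ∀ (c₀ : Config (suc k) n) xs → ValidInput xs →
    expCost w algorithm c₀ xs ≤ℚ ι (2 ^ (2 ℕ.* suc k ℕ.* suc k)) * patternCost w (revealed xs)
  competitive {k} w 0≤w c₀ [] _ = *-nonNeg (0≤ι (2 ^ (2 ℕ.* suc k ℕ.* suc k))) (patternCost-nonNeg w 0≤w (emptyPattern (suc k)))
  competitive {k} w 0≤w c₀ xs@(x ∷ fut) valid = begin
    expCost w algorithm c₀ xs
      ≤⟨ expCost-bound w (toVec-nonNegs w 0≤w) ℕₚ.≤-refl c₀ x fut (valid⇒traceable xs valid) ⟩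
    pow (ι (2 ^ suc (suc k))) (suc k) * patternCost w (pattern-of (reverse xs))
      ≤⟨ *-monoˡ (patternCost-nonNeg w 0≤w (pattern-of (reverse xs))) (total-factor k) ⟩
    ι (2 ^ (2 ℕ.* suc k ℕ.* suc k)) * patternCost w (pattern-of (reverse xs))
      ≡⟨ cong (λ P → ι (2 ^ (2 ℕ.* suc k ℕ.* suc k)) * patternCost w P) (sym (revealFrom-pattern-of [] xs)) ⟩
    ι (2 ^ (2 ℕ.* suc k ℕ.* suc k)) * patternCost w (revealed xs) ∎
    where
    open ≤-Reasoning
    -- `Y` is the bound for the top index and so dominates those of all lower levels; `q` = 2^(k+2)
    -- is one factor per level.
    open Competitive (bound (suc k)) (ι (2 ^ suc (suc k))) (moves-per-level k)
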